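{- Let $G$ be a finite simple connected graph on at least three vertices that is not fractionally Hamiltonian. Then there exists a finite simple graph $H$ with $V(H)=V(G)$ and $E(G)\subseteq E(H)$ such that $H$ is chordal and $H$ is not Hamiltonian. In other words, every connected graph on at least three vertices that is not fractionally Hamiltonian has a non-Hamiltonian chordal spanning supergraph.
   Context: All graphs are finite and simple. A graph is Hamiltonian if it contains a cycle through all of its vertices. A graph is chordal if it has no induced cycle of length at least four. For a nonempty proper set $S\subsetneq V(G)$, let $\partial(S):=\{uv\in E(G): |\{u,v\}\cap S|=1\}$. For an edge weighting $f:E(G)\to\mathbb R$ and $F\subseteq E(G)$, write $f(F):=\sum_{e\in F}f(e)$. A fractional Hamiltonian cycle of $G$ is an edge weighting $f:E(G)\to[0,1]$ such that $f(E(G))=|V(G)|$ and $f(\partial(S))\ge 2$ for every nonempty proper set $S\subsetneq V(G)$. A graph is fractionally Hamiltonian if it has a fractional Hamiltonian cycle. -}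

module Defs where

open import Algebra.Bundles using (CommutativeMonoid)
import Algebra.Properties.CommutativeSemigroup as CommutativeSemigroupProperties
open import Data.Bool.Base using (Bool; false; T)
open import Data.Bool.Properties using (T?)
open import Data.Fin.Base using (Fin; toℕ) renaming (_<_ to _<ᶠ_)
open import Data.Fin.Properties using (nonZeroIndex) renaming (_<?_ to _<ᶠ?_)
open import Data.Fin.Subset using (Subset; Nonempty; ⊤; ⁅_⁆; _∪_; _∩_; _⊂_; ∣_∣)
open import Data.List.Base using (List; allFin; cartesianProduct; filter; foldr; map; mapMaybe)
open import Data.Maybe.Base as Maybe using (Maybe)
open import Data.Integer.Base using (+_)
open import Data.Nat.Base as ℕ using (ℕ; suc; _⊔_)
open import Data.Nat.DivMod using (_mod_)
import Data.Nat.Properties as ℕ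
open import Data.Product.Base using (∃; ∃₂; _×_; _,_)
open import Data.Rational.Base as ℚ using (ℚ; 0ℚ; ½)
import Data.Rational.Properties as ℚ
open import Data.Sum.Base using (_⊎_)
open import Function.Definitions using (Injective)
open import Level using (0ℓ)
open import Relation.Binary.Construct.Closure.ReflexiveTransitive using (Star)
open import Relation.Binary.PropositionalEquality using (_≡_; cong; sym; subst; subst₂; trans)
open import Relation.Nullary using (¬_)
open import Relation.Nullary.Decidable using (dec⇒maybe; _×-dec_)
open import Relation.Unary using (Pred; Decidable)
open import Relation.Unary.Properties using (U?)

------------------------------------------------------------------------
-- Real numbers as Cauchy sequences of rationals; equality of reals is _≈_.

IsCauchy : (ℕ → ℚ) → Set
IsCauchy x = ∀ ε → 0ℚ ℚ.< ε →
  ∃ λ N → ∀ k l → N ℕ.≤ k → N ℕ.≤ l → ℚ.∣ x k ℚ.- x l ∣ ℚ.< ε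

record ℝ : Set where
  constructor mkℝ
  field
    seq    : ℕ → ℚ
    cauchy : IsCauchy seq

open ℝ public

infix  4 _≈_ _≤_
infixl 6 _+_

_≈_ : ℝ → ℝ → Set
x ≈ y = ∀ ε → 0ℚ ℚ.< ε →
  ∃ λ N → ∀ k → N ℕ.≤ k → ℚ.∣ seq x k ℚ.- seq y k ∣ ℚ.< ε

_≤_ : ℝ → ℝ → Set
x ≤ y = ∀ ε → 0ℚ ℚ.< ε →
  ∃ λ N → ∀ k → N ℕ.≤ k → seq x k ℚ.< seq y k ℚ.+ ε

fromℚ : ℚ → ℝ
fromℚ q = mkℝ (λ _ → q) λ ε 0<ε →
  0 , λ _ _ _ _ → subst (λ d → ℚ.∣ d ∣ ℚ.< ε) (sym (ℚ.+-inverseʳ q)) 0<ε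

fromℕ : ℕ → ℝ
fromℕ n = fromℚ (+ n ℚ./ 1)

private
  half-pos : ∀ ε → 0ℚ ℚ.< ε → 0ℚ ℚ.< ½ ℚ.* ε
  half-pos ε 0<ε =
    subst (ℚ._< ½ ℚ.* ε) (ℚ.*-zeroʳ ½) (ℚ.*-monoʳ-<-pos ½ 0<ε)

  half+half : ∀ ε → ½ ℚ.* ε ℚ.+ ½ ℚ.* ε ≡ ε
  half+half ε = trans (sym (ℚ.*-distribʳ-+ ε ½ ½)) (ℚ.*-identityˡ ε)

  interchange : ∀ a b c d → (a ℚ.- c) ℚ.+ (b ℚ.- d) ≡ (a ℚ.+ b) ℚ.- (c ℚ.+ d)
  interchange a b c d = trans (medial a (ℚ.- c) b (ℚ.- d))
    (cong (a ℚ.+ b ℚ.+_) (sym (ℚ.neg-distrib-+ c d)))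
    where open CommutativeSemigroupProperties
                 (CommutativeMonoid.commutativeSemigroup ℚ.+-0-commutativeMonoid)
                 using () renaming (interchange to medial)

  +-cauchy : ∀ x y → IsCauchy x → IsCauchy y → IsCauchy (λ k → x k ℚ.+ y k)
  +-cauchy x y cx cy ε 0<ε
    with M , p ← cx (½ ℚ.* ε) (half-pos ε 0<ε)
       | N , q ← cy (½ ℚ.* ε) (half-pos ε 0<ε)
    = M ⊔ N , λ k l ≤k ≤l →
      subst₂ (λ d e → ℚ.∣ d ∣ ℚ.< e)
        (interchange (x k) (y k) (x l) (y l)) (half+half ε)
        (ℚ.≤-<-trans (ℚ.∣p+q∣≤∣p∣+∣q∣ (x k ℚ.- x l) (y k ℚ.- y l))
          (ℚ.+-mono-<
            (p k l (ℕ.m⊔n≤o⇒m≤o M N ≤k) (ℕ.m⊔n≤o⇒m≤o M N ≤l))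
            (q k l (ℕ.m⊔n≤o⇒n≤o M N ≤k) (ℕ.m⊔n≤o⇒n≤o M N ≤l))))

_+_ : ℝ → ℝ → ℝ
x + y = mkℝ (λ k → seq x k ℚ.+ seq y k) (+-cauchy (seq x) (seq y) (cauchy x) (cauchy y))

sumℝ : List ℝ → ℝ
sumℝ = foldr _+_ (fromℕ 0)

------------------------------------------------------------------------
-- Finite simple graphs on the vertex set Fin n

record Graph (n : ℕ) : Set where
  field
    adj    : Fin n → Fin n → Bool
    symm   : ∀ u v → adj u v ≡ adj v u
    irrefl : ∀ v → adj v v ≡ false

  Adj : Fin n → Fin n → Set
  Adj u v = T (adj u v)

open Graph public using (Adj)

-- The unordered edge {u , v} is represented by its endpoints in increasing
-- order; both proof fields are propositions, so this is one element per edge.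
record Edge {n : ℕ} (G : Graph n) : Set where
  constructor mkEdge
  field
    src tgt  : Fin n
    src<tgt  : src <ᶠ tgt
    adjacent : Adj G src tgt

edges : ∀ {n} (G : Graph n) → List (Edge G)
edges {n} G = mapMaybe edge? (cartesianProduct (allFin n) (allFin n))
  where
  edge? : Fin n × Fin n → Maybe (Edge G)
  edge? (u , v) = Maybe.map (λ (u<v , uv) → mkEdge u v u<v uv)
    (dec⇒maybe ((u <ᶠ? v) ×-dec T? (Graph.adj G u v)))

Connected : ∀ {n} → Graph n → Set
Connected G = ∀ u v → Star (Adj G) u v

_SpanningSubgraphOf_ : ∀ {n} → Graph n → Graph n → Set
G SpanningSubgraphOf H = ∀ u v → Adj G u v → Adj H u v

------------------------------------------------------------------------
-- Cycles

sucMod : ∀ {k} → Fin k → Fin k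
sucMod {k} i = (suc (toℕ i) mod k) {{nonZeroIndex i}}

record Cycle {n : ℕ} (G : Graph n) (k : ℕ) : Set where
  field
    3≤length  : 3 ℕ.≤ k
    vertex    : Fin k → Fin n
    injective : Injective _≡_ _≡_ vertex
    adjacent  : ∀ i → Adj G (vertex i) (vertex (sucMod i))

Induced : ∀ {n} {G : Graph n} {k} → Cycle G k → Set
Induced {G = G} C = ∀ i j → Adj G (vertex i) (vertex j) → j ≡ sucMod i ⊎ i ≡ sucMod j
  where open Cycle C

Hamiltonian : ∀ {n} → Graph n → Set
Hamiltonian G = ∃₂ λ k (C : Cycle G k) → ∀ v → ∃ λ i → Cycle.vertex C i ≡ v

Chordal : ∀ {n} → Graph n → Set
Chordal G = ∀ k → 4 ℕ.≤ k → (C : Cycle G k) → ¬ Induced C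

------------------------------------------------------------------------
-- Fractional Hamiltonian cycles

∂ : ∀ {n} {G : Graph n} → Subset n → Pred (Edge G) 0ℓ
∂ S e = ∣ (⁅ src ⁆ ∪ ⁅ tgt ⁆) ∩ S ∣ ≡ 1
  where open Edge e

∂? : ∀ {n} {G : Graph n} (S : Subset n) → Decidable (∂ {G = G} S)
∂? S e = ∣ (⁅ src ⁆ ∪ ⁅ tgt ⁆) ∩ S ∣ ℕ.≟ 1
  where open Edge e

-- f(F) for a decidable set F of edges
weight : ∀ {n} {G : Graph n} → (Edge G → ℝ) → {F : Pred (Edge G) 0ℓ} → Decidable F → ℝ
weight {G = G} f F? = sumℝ (map f (filter F? (edges G)))

record IsFractionalHamiltonianCycle {n : ℕ} (G : Graph n) (f : Edge G → ℝ) : Set where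
  field
    0≤f   : ∀ e → fromℕ 0 ≤ f e
    f≤1   : ∀ e → f e ≤ fromℕ 1
    total : weight f U? ≈ fromℕ n
    cut   : ∀ (S : Subset n) → Nonempty S → S ⊂ ⊤ → fromℕ 2 ≤ weight f (∂? S)

FractionallyHamiltonian : ∀ {n} → Graph n → Set
FractionallyHamiltonian G = ∃ (IsFractionalHamiltonianCycle G)

-- By linear programming duality, a graph G on n vertices without fractional Hamiltonian cycle has
-- a family of N cuts and a number k such that every edge of G lies in at most k of the cuts and
-- 2 N > n k. Replacing crossing sets S, T by S ∩ T, S ∪ T does not increase the number of cuts
-- through any pair of vertices, so the family may be taken laminar. The number d(u,v) of cuts
-- separating u from v is then a tree metric, and H joins u and v whenever d(u,v) ≤ k. The
-- four-point condition makes H chordal. A Hamiltonian cycle of H would meet each cut at least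
-- twice, whereas its n edges lie on at most n k cuts altogether.
module Submission where

open import Defs renaming (_≤_ to _≤ʳ_; _+_ to _+ʳ_; _≈_ to _≈ʳ_)
open import Data.Bool.Base using (Bool; true; false; not; _∧_; _∨_; _xor_; T)
import Data.Bool.Properties as Bool
open import Data.Fin.Base as Fin using (Fin; zero; suc; toℕ; fromℕ<)
open import Data.Fin.Properties as Fin using (nonZeroIndex; toℕ<n; toℕ-injective; toℕ-fromℕ<; injective⇒≤)
open import Data.Integer.Base as ℤ using (ℤ)
import Data.Integer.Properties as ℤ
import Data.Integer.Tactic.RingSolver as ℤSolver
open import Data.List.Base
  using (List; []; _∷_; _++_; [_]; map; mapMaybe; length; allFin; cartesianProductWith; filter)
import Data.List.Extrema.Nat as Extrema
open import Data.List.Membership.Propositional using (_∈_; find; lose)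
open import Data.List.Membership.Propositional.Properties
  using (∈-allFin; ∈-cartesianProduct⁺; ∈-cartesianProductWith⁺; ∈-map⁺; ∈-++⁺ˡ; ∈-++⁺ʳ)
open import Data.List.Properties using (map-++; map-cong; map-tabulate; length-++; length-tabulate)
open import Data.List.Relation.Binary.Permutation.Propositional
  using (_↭_; ↭-refl; ↭-trans; prep; swap)
open import Data.List.Relation.Binary.Permutation.Propositional.Properties
  using (All-resp-↭; ∈-resp-↭; ↭-length; map⁺)
open import Data.List.Relation.Unary.All as All using (All; []; _∷_)
import Data.List.Relation.Unary.All.Properties as All
open import Data.List.Relation.Unary.AllPairs using ([]; _∷_)
open import Data.List.Relation.Unary.Any as Any using (here; there)
open import Data.List.Relation.Unary.Unique.Propositional using (Unique)
import Data.List.Relation.Unary.Unique.Propositional.Properties as Unique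
open import Data.Maybe.Base as Maybe using (Maybe; just; nothing)
open import Data.Maybe.Properties using (just-injective; ≡-dec)
open import Data.Nat.Base as ℕ using (ℕ; zero; suc) renaming (_≤_ to _≤ᴺ_)
open import Data.Product.Base using (∃; ∃₂; Σ; _×_; _,_; proj₁; proj₂)
open import Data.Rational.Base as ℚ using (ℚ)
import Data.Rational.Properties as ℚ
open import Data.Rational.Unnormalised.Base as ℚᵘ using (mkℚᵘ; *≡*; *≤*)
import Data.Rational.Unnormalised.Properties as ℚᵘ
open import Data.Sum.Base as Sum using (_⊎_; inj₁; inj₂)
open import Data.Vec.Base using ([]; _∷_; lookup; here; there)
open import Data.Vec.Properties using (lookup-zipWith; lookup-map; lookup-replicate; []=⇒lookup; lookup⇒[]=)
open import Function.Base using (id; _∘_)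
open import Function.Bundles using (mk⇔)
open import Level using (0ℓ)
open import Relation.Binary.Definitions using (DecidableEquality; tri<; tri≈; tri>)
open import Relation.Binary.PropositionalEquality hiding ([_])
open import Relation.Nullary using (¬_; Dec; yes; no; contradiction)
open import Relation.Nullary.Decidable
  using (map′; isYes; isYes≗does; dec-false; dec⇒maybe; does-⇔; toWitness; fromWitness; _×-dec_; _→-dec_; ¬?)
open import Relation.Unary using (Pred; Decidable)
open import Relation.Unary.Properties using (U?)

-- Linear inequalities over the integers: Fourier–Motzkin elimination

-- The hypothesis is a negation and weights are Cauchy reals, so duality is proved as an explicit
-- alternative. Elimination over the integers returns either a solution `y`, `d` of the homogenised
-- system, read as the rational weighting `y / d`, or a refuting combination of rows, and the
-- negation excludes the first case.
--
-- The linear program is kept to two kinds of constraints: the total is at most `n d`, and each cut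
-- has weight at least `2 d`. Its dual therefore has one multiplicity per cut and one number `k` for
-- the total, and `2 N > n k` is the sign of the constant term. The remaining constraints on a
-- fractional Hamiltonian cycle are recovered afterwards from the degrees.
--
-- Every cut is represented by its side missing the vertex `zero`. Intersections and unions again
-- miss `zero`, so uncrossing never needs complements. The same vertex is the root of the tree
-- metric in the chordality argument, and it is the vertex outside every side that a Hamiltonian
-- cycle must visit.

module Farkas where
  open import Data.Integer.Base hiding (suc)
  open import Data.Integer.Properties
  open ℤSolver using (solve-∀)

  -- A row r stands for the inequality Σ coef r j · x j ≥ 0. Nonnegative combinations are formed in
  -- an abstract monoid, so that a refutation remembers which inequalities it is made of.
  record RowMonoid (J : Set) : Set₁ where
    infixl 6 _⊕_
    field
      Row    : Set
      ε      : Row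
      _⊕_    : Row → Row → Row
      coef   : Row → J → ℤ
      coef-ε : ∀ j → coef ε j ≡ 0ℤ
      coef-⊕ : ∀ r s j → coef (r ⊕ s) j ≡ coef r j + coef s j

    _×ʳ_ : ℕ → Row → Row
    0     ×ʳ r = ε
    suc k ×ʳ r = r ⊕ (k ×ʳ r)

    coef-×ʳ : ∀ k r j → coef (k ×ʳ r) j ≡ + k * coef r j
    coef-×ʳ 0       r j = trans (coef-ε j) (sym (*-zeroˡ (coef r j)))
    coef-×ʳ (suc k) r j = begin
      coef (r ⊕ (k ×ʳ r)) j        ≡⟨ coef-⊕ r (k ×ʳ r) j ⟩
      coef r j + coef (k ×ʳ r) j   ≡⟨ cong (λ z → coef r j + z) (coef-×ʳ k r j) ⟩
      coef r j + + k * coef r j    ≡⟨ suc-* (+ k) (coef r j) ⟨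
      + suc k * coef r j           ∎
      where open ≡-Reasoning

  -- - η / α is the largest among 0 and the lower bounds - e r / a r given by the r with a r > 0.
  tightest : ∀ {A : Set} (a e : A → ℤ) (rs : List A) → ∃₂ λ α η → 0ℤ < α × η ≤ 0ℤ ×
    (∀ {r} → r ∈ rs → 0ℤ < a r → a r * η ≤ α * e r) ×
    ((α ≡ 1ℤ × η ≡ 0ℤ) ⊎ ∃ λ p → p ∈ rs × 0ℤ < a p × α ≡ a p × η ≡ e p)
  tightest a e [] = 1ℤ , 0ℤ , +<+ (ℕ.s≤s ℕ.z≤n) , ≤-refl , (λ ()) , inj₁ (refl , refl)
  tightest a e (r ∷ rs)
    with α , η , 0<α , η≤0 , below , origin ← tightest a e rs
    with 0ℤ <? a r
  ... | no a≯0 = α , η , 0<α , η≤0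
      , (λ { (here refl) 0<a → contradiction 0<a a≯0 ; (there r∈) → below r∈ })
      , Sum.map₂ (λ (p , p∈ , p-tight) → p , there p∈ , p-tight) origin
  ... | yes 0<ar with a r * η ≤? α * e r
  ...   | yes le = α , η , 0<α , η≤0
      , (λ { (here refl) _ → le ; (there r∈) → below r∈ })
      , Sum.map₂ (λ (p , p∈ , p-tight) → p , there p∈ , p-tight) origin
  ...   | no ¬le = a r , e r , 0<ar , e≤0 , new , inj₂ (r , here refl , 0<ar , refl , refl)
    where
    instance
      α⁺ : Positive α
      α⁺ = positive 0<α
      α⁰ : NonNegative α
      α⁰ = nonNegative (<⇒≤ 0<α)
      r⁰ : NonNegative (a r)
      r⁰ = nonNegative (<⇒≤ 0<ar)

    lt : α * e r ≤ a r * η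
    lt = <⇒≤ (≰⇒> ¬le)

    e≤0 : e r ≤ 0ℤ
    e≤0 = *-cancelˡ-≤-pos (e r) 0ℤ α (begin
      α * e r   ≤⟨ lt ⟩
      a r * η   ≤⟨ *-monoˡ-≤-nonNeg (a r) η≤0 ⟩
      a r * 0ℤ  ≡⟨ *-zeroʳ (a r) ⟩
      0ℤ        ≡⟨ *-zeroʳ α ⟨
      α * 0ℤ    ∎)
      where open ≤-Reasoning

    swap₃ : ∀ x y z → x * (y * z) ≡ y * (x * z)
    swap₃ = solve-∀

    new : ∀ {s} → s ∈ r ∷ rs → 0ℤ < a s → a s * e r ≤ a r * e s
    new (here refl) _ = ≤-refl
    -- Transitivity of `e r / a r ≤ η / α ≤ e s / a s` without division: multiply by `α`, pass
    -- through `η`, cancel `α`.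
    new {s} (there s∈) 0<as = *-cancelˡ-≤-pos _ _ α (begin
      α * (a s * e r)   ≡⟨ swap₃ α (a s) (e r) ⟩
      a s * (α * e r)   ≤⟨ *-monoˡ-≤-nonNeg (a s) lt ⟩
      a s * (a r * η)   ≡⟨ swap₃ (a s) (a r) η ⟩
      a r * (a s * η)   ≤⟨ *-monoˡ-≤-nonNeg (a r) (below s∈ 0<as) ⟩
      a r * (α * e s)   ≡⟨ swap₃ (a r) α (e s) ⟩
      α * (a r * e s)   ∎)
      where
      open ≤-Reasoning
      instance
        s⁰ : NonNegative (a s)
        s⁰ = nonNegative (<⇒≤ 0<as)

  module _ {J : Set} (_≟_ : DecidableEquality J) (o : J) where

    open RowMonoid

    -- The index o is never eliminated: x o is the common denominator, coef r o the constant term.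
    eval : (M : RowMonoid J) → List J → (J → ℤ) → Row M → ℤ
    eval M []       x r = coef M r o * x o
    eval M (j ∷ js) x r = coef M r j * x j + eval M js x r

    Solvable : (M : RowMonoid J) → List J → List (Row M) → Set
    Solvable M js rs = ∃ λ x → (∀ j → 0ℤ ≤ x j) × 0ℤ < x o × (∀ {r} → r ∈ rs → 0ℤ ≤ eval M js x r)

    Refutable : (M : RowMonoid J) → List J → Set
    Refutable M js = ∃ λ r → (∀ {j} → j ∈ js → coef M r j ≤ 0ℤ) × coef M r o < 0ℤ

    -- Back substitution wants the fraction `y / t` at `i`. As the system is homogeneous, every
    -- other coordinate can be scaled by `t` instead, which keeps the solution integral.
    update : J → ℤ → ℤ → (J → ℤ) → J → ℤ
    update i t y x j with i ≟ j
    ... | yes _ = y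
    ... | no  _ = t * x j

    update-≡ : ∀ i t y x → update i t y x i ≡ y
    update-≡ i t y x with i ≟ i
    ... | yes _  = refl
    ... | no i≢i = contradiction refl i≢i

    update-≢ : ∀ {i j} t y x → i ≢ j → update i t y x j ≡ t * x j
    update-≢ {i} {j} t y x i≢j with i ≟ j
    ... | yes i≡j = contradiction i≡j i≢j
    ... | no _    = refl

    eval-update : ∀ M {i} t y x js r → o ≢ i → All (i ≢_) js →
      eval M js (update i t y x) r ≡ t * eval M js x r
    eval-update M {i} t y x [] r o≢i [] = begin
      coef M r o * update i t y x o  ≡⟨ cong (coef M r o *_) (update-≢ t y x (≢-sym o≢i)) ⟩
      coef M r o * (t * x o)         ≡⟨ lem (coef M r o) t (x o) ⟩
      t * (coef M r o * x o)         ∎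
      where
      open ≡-Reasoning
      lem : ∀ a b c → a * (b * c) ≡ b * (a * c)
      lem = solve-∀
    eval-update M {i} t y x (j ∷ js) r o≢i (i≢j ∷ i∉js) = begin
      coef M r j * update i t y x j + eval M js (update i t y x) r
        ≡⟨ cong₂ (λ u v → coef M r j * u + v) (update-≢ t y x i≢j) (eval-update M t y x js r o≢i i∉js) ⟩
      coef M r j * (t * x j) + t * eval M js x r
        ≡⟨ lem (coef M r j) t (x j) (eval M js x r) ⟩
      t * (coef M r j * x j + eval M js x r) ∎
      where
      open ≡-Reasoning
      lem : ∀ a b c d → a * (b * c) + b * d ≡ b * (a * c + d)
      lem = solve-∀

    eval-linear : ∀ M js x β γ {p q r} → (∀ j → coef M r j ≡ β * coef M p j + γ * coef M q j) →
      eval M js x r ≡ β * eval M js x p + γ * eval M js x q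
    eval-linear M [] x β γ {p} {q} {r} eq =
      trans (cong (_* x o) (eq o)) (lem β γ (coef M p o) (coef M q o) (x o))
      where
      lem : ∀ a b c d e → (a * c + b * d) * e ≡ a * (c * e) + b * (d * e)
      lem = solve-∀
    eval-linear M (j ∷ js) x β γ {p} {q} {r} eq =
      trans (cong₂ (λ u v → u * x j + v) (eq j) (eval-linear M js x β γ {p} {q} {r} eq))
        (lem β γ (coef M p j) (coef M q j) (x j) (eval M js x p) (eval M js x q))
      where
      lem : ∀ a b c d e u v → (a * c + b * d) * e + (a * u + b * v) ≡ a * (c * e + u) + b * (d * e + v)
      lem = solve-∀

    -- As variables are nonnegative, a combination refutes as soon as its coefficients are ≤ 0.
    nonPositiveAt : RowMonoid J → J → RowMonoid J
    nonPositiveAt M i = record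
      { Row    = Σ (Row M) λ r → coef M r i ≤ 0ℤ
      ; ε      = ε M , ≤-reflexive (coef-ε M i)
      ; _⊕_    = λ (r , r≤0) (s , s≤0) → _⊕_ M r s ,
                   subst (_≤ 0ℤ) (sym (coef-⊕ M r s i)) (+-mono-≤ r≤0 s≤0)
      ; coef   = λ r → coef M (proj₁ r)
      ; coef-ε = coef-ε M
      ; coef-⊕ = λ r s → coef-⊕ M (proj₁ r) (proj₁ s)
      }

    eval-nonPositiveAt : ∀ M i js x r →
      eval (nonPositiveAt M i) js x r ≡ eval M js x (proj₁ r)
    eval-nonPositiveAt M i []       x r = refl
    eval-nonPositiveAt M i (j ∷ js) x r = cong (λ z → coef M (proj₁ r) j * x j + z) (eval-nonPositiveAt M i js x r)

    module _ (M : RowMonoid J) (i : J) where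

      private
        Pos NonPos : Set
        Pos    = Σ (Row M) λ r → 0ℤ < coef M r i
        NonPos = Σ (Row M) λ r → coef M r i ≤ 0ℤ

      -- The multiplicities are absolute values because `_×ʳ_` only repeats a row a natural number
      -- of times. For `p` positive and `q` nonpositive at `i`, the two contributions at `i` cancel.
      combine-row : Row M → Row M → Row M
      combine-row p q = _⊕_ M (_×ʳ_ M ∣ coef M q i ∣ p) (_×ʳ_ M ∣ coef M p i ∣ q)

      coef-combine : ∀ {p q} → 0ℤ < coef M p i → coef M q i ≤ 0ℤ → ∀ j →
        coef M (combine-row p q) j ≡ - coef M q i * coef M p j + coef M p i * coef M q j
      coef-combine {p} {q} 0<p q≤0 j = begin
        coef M (combine-row p q) j
          ≡⟨ coef-⊕ M _ _ j ⟩
        coef M (_×ʳ_ M ∣ coef M q i ∣ p) j + coef M (_×ʳ_ M ∣ coef M p i ∣ q) j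
          ≡⟨ cong₂ _+_ (coef-×ʳ M ∣ coef M q i ∣ p j) (coef-×ʳ M ∣ coef M p i ∣ q j) ⟩
        + ∣ coef M q i ∣ * coef M p j + + ∣ coef M p i ∣ * coef M q j
          ≡⟨ cong₂ (λ u v → u * coef M p j + v * coef M q j)
               (trans (cong +_ (sym (∣-i∣≡∣i∣ (coef M q i)))) (0≤i⇒+∣i∣≡i (neg-mono-≤ q≤0)))
               (0≤i⇒+∣i∣≡i (<⇒≤ 0<p)) ⟩
        - coef M q i * coef M p j + coef M p i * coef M q j ∎
        where open ≡-Reasoning

      combine : Pos → NonPos → NonPos
      combine (p , 0<p) (q , q≤0) = combine-row p q ,
        ≤-reflexive (trans (coef-combine 0<p q≤0 i) (lem (coef M q i) (coef M p i)))
        where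
        lem : ∀ a b → - a * b + b * a ≡ 0ℤ
        lem = solve-∀

      split : List (Row M) → List Pos × List NonPos
      split [] = [] , []
      split (r ∷ rs) with 0ℤ <? coef M r i | split rs
      ... | yes 0<r | ps , qs = (r , 0<r) ∷ ps , qs
      ... | no  r≯0 | ps , qs = ps , (r , ≮⇒≥ r≯0) ∷ qs

      ∈-split : ∀ {r} rs → r ∈ rs →
        (∃ λ 0<r → (r , 0<r) ∈ proj₁ (split rs)) ⊎ (∃ λ r≤0 → (r , r≤0) ∈ proj₂ (split rs))
      ∈-split (r ∷ rs) (here refl) with 0ℤ <? coef M r i
      ... | yes 0<r = inj₁ (0<r , here refl)
      ... | no  r≯0 = inj₂ (_ , here refl)
      ∈-split (s ∷ rs) (there r∈) with 0ℤ <? coef M s i | ∈-split rs r∈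
      ... | yes _ | inj₁ (h , m) = inj₁ (h , there m)
      ... | yes _ | inj₂ (h , m) = inj₂ (h , m)
      ... | no  _ | inj₁ (h , m) = inj₁ (h , m)
      ... | no  _ | inj₂ (h , m) = inj₂ (h , there m)

      -- The rows `qs` stay in the list as their combinations with the implicit inequality
      -- `x i ≥ 0`; the products combine them with the explicit lower bounds on `x i`.
      eliminate : List (Row M) → List NonPos
      eliminate rs = let ps , qs = split rs in qs ++ cartesianProductWith combine ps qs

      back-substitute : ∀ js rs → o ≢ i → All (i ≢_) js →
        Solvable (nonPositiveAt M i) js (eliminate rs) → Solvable M (i ∷ js) rs
      back-substitute js rs o≢i i∉js (x , 0≤x , 0<xo , sat)
        with α , η , 0<α , η≤0 , below , origin ←
          tightest (λ (r : Pos) → coef M (proj₁ r) i) (λ r → eval M js x (proj₁ r)) (proj₁ (split rs))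
        = x′ , 0≤x′ , 0<x′o , sat′
        where
        x′ : J → ℤ
        x′ = update i α (- η) x

        instance
          α⁺ : Positive α
          α⁺ = positive 0<α
          α⁰ : NonNegative α
          α⁰ = nonNegative (<⇒≤ 0<α)

        0≤α* : ∀ {z} → 0ℤ ≤ z → 0ℤ ≤ α * z
        0≤α* {z} 0≤z = subst (_≤ α * z) (*-zeroʳ α) (*-monoˡ-≤-nonNeg α 0≤z)

        0≤x′ : ∀ j → 0ℤ ≤ x′ j
        0≤x′ j with i ≟ j
        ... | yes _ = neg-mono-≤ η≤0
        ... | no  _ = 0≤α* (0≤x j)

        0<x′o : 0ℤ < x′ o
        0<x′o = subst₂ _<_ (*-zeroʳ α) (sym (update-≢ α (- η) x (≢-sym o≢i)))
          (*-monoˡ-<-pos α 0<xo)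

        E : Row M → ℤ
        E = eval M js x

        eval-x′ : ∀ r → eval M (i ∷ js) x′ r ≡ α * E r - coef M r i * η
        eval-x′ r = trans
          (cong₂ (λ u v → coef M r i * u + v) (update-≡ i α (- η) x) (eval-update M α (- η) x js r o≢i i∉js))
          (lem (coef M r i) η (α * E r))
          where
          lem : ∀ a b c → a * - b + c ≡ c - a * b
          lem = solve-∀

        sat-NonPos : ∀ {q} → q ∈ eliminate rs → 0ℤ ≤ E (proj₁ q)
        sat-NonPos {q} q∈ = subst (0ℤ ≤_) (eval-nonPositiveAt M i js x q) (sat q∈)

        upper : ∀ {q} → q ∈ proj₂ (split rs) → coef M (proj₁ q) i * η ≤ α * E (proj₁ q)
        upper {q} q∈ = from origin
          where
          lem : ∀ a b c → - a * b + c ≡ c - a * b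
          lem = solve-∀

          Bound : ℤ → ℤ → Set
          Bound a h = coef M (proj₁ q) i * h ≤ a * E (proj₁ q)

          -- If the tightest lower bound is 0, row `q` itself, kept by `eliminate`, gives the claim;
          -- if it comes from a row `p`, the claim is the inequality of `combine p q`.
          from : _ → Bound α η
          from (inj₁ (α≡1 , η≡0)) = subst₂ Bound (sym α≡1) (sym η≡0)
            (subst₂ _≤_ (sym (*-zeroʳ (coef M (proj₁ q) i))) (sym (*-identityˡ _)) (sat-NonPos (∈-++⁺ˡ q∈)))
          from (inj₂ (p , p∈ , _ , α≡ , η≡)) = subst₂ Bound (sym α≡) (sym η≡)
            (0≤i-j⇒j≤i (subst (0ℤ ≤_)
              (trans
                (eval-linear M js x (- coef M (proj₁ q) i) (coef M (proj₁ p) i) {proj₁ p} {proj₁ q}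
                  (coef-combine (proj₂ p) (proj₂ q)))
                (lem (coef M (proj₁ q) i) (E (proj₁ p)) (coef M (proj₁ p) i * E (proj₁ q))))
              (sat-NonPos {combine p q}
                (∈-++⁺ʳ (proj₂ (split rs)) (∈-cartesianProductWith⁺ combine p∈ q∈)))))

        sat′ : ∀ {r} → r ∈ rs → 0ℤ ≤ eval M (i ∷ js) x′ r
        sat′ {r} r∈ = subst (0ℤ ≤_) (sym (eval-x′ r)) (i≤j⇒0≤j-i (bound (∈-split rs r∈)))
          where
          bound : _ → coef M r i * η ≤ α * E r
          bound (inj₁ (0<r , m)) = below m 0<r
          bound (inj₂ (r≤0 , m)) = upper m

    -- Quantifying over `M` lets the recursion change the monoid: a row of `nonPositiveAt M i`
    -- carries the sign of its coefficient at `i`, so a refutation found after eliminating `i` is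
    -- already one before it.
    farkas : ∀ M js → Unique (o ∷ js) → ∀ rs → Solvable M js rs ⊎ Refutable M js
    farkas M [] _ [] = inj₁ ((λ _ → 1ℤ) , (λ _ → +≤+ ℕ.z≤n) , +<+ (ℕ.s≤s ℕ.z≤n) , λ ())
    farkas M [] u (r ∷ rs) with coef M r o <? 0ℤ | farkas M [] u rs
    ... | yes r<0 | _ = inj₂ (r , (λ ()) , r<0)
    ... | no  _   | inj₂ refutation = inj₂ refutation
    ... | no  r≮0 | inj₁ (x , 0≤x , 0<xo , sat) = inj₁ (x , 0≤x , 0<xo , λ
      { (here refl) → subst (_≤ coef M r o * x o) (*-zeroˡ (x o))
          (*-monoʳ-≤-nonNeg (x o) {{nonNegative (0≤x o)}} (≮⇒≥ r≮0))
      ; (there r∈)  → sat r∈ })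
    farkas M (i ∷ js) ((o≢i ∷ o∉js) ∷ (i∉js ∷ u)) rs
      with farkas (nonPositiveAt M i) js (o∉js ∷ u) (eliminate M i rs)
    ... | inj₁ solution = inj₁ (back-substitute M i js rs o≢i i∉js solution)
    ... | inj₂ ((r , r≤0) , nonpos , neg) = inj₂ (r , (λ { (here refl) → r≤0 ; (there j∈) → nonpos j∈ }) , neg)

open import Data.Fin.Subset as Subset
  using (Subset; Nonempty; inside; outside; ⊤; ⊥; ⁅_⁆; _∩_; _∪_; ∁; ∣_∣; _⊂_)
open import Data.Fin.Subset.Properties as Subset using (nonempty?; p⊂q⇒∣p∣<∣q∣; ∣p∣≤n)
open import Data.Nat.Base using (_+_; _*_; _∸_; _≤_; _<_; z≤n; s≤s; NonZero)
open import Data.Nat.DivMod using (_%_; _/_; m≡m%n+[m/n]*n; m%n<n; m<n⇒m%n≡m; [m+kn]%n≡m%n)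
open import Data.Nat.ListAction using (sum)
open import Data.Nat.ListAction.Properties using (sum-++; sum-↭)
open import Data.Nat.Properties
open import Data.Nat.Tactic.RingSolver using (solve-∀)

-- Finite sums

∑ : ∀ {A : Set} → List A → (A → ℕ) → ℕ
∑ xs f = sum (map f xs)

module _ {A : Set} where

  ∑-cong : ∀ {f g : A → ℕ} → (∀ x → f x ≡ g x) → ∀ xs → ∑ xs f ≡ ∑ xs g
  ∑-cong f≗g xs = cong sum (map-cong f≗g xs)

  ∑-mono : ∀ {f g : A → ℕ} xs → (∀ {x} → x ∈ xs → f x ≤ g x) → ∑ xs f ≤ ∑ xs g
  ∑-mono []       f≤g = z≤n
  ∑-mono (x ∷ xs) f≤g = +-mono-≤ (f≤g (here refl)) (∑-mono xs (λ x∈ → f≤g (there x∈)))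

  ∑-+ : ∀ (f g : A → ℕ) xs → ∑ xs (λ x → f x + g x) ≡ ∑ xs f + ∑ xs g
  ∑-+ f g []       = refl
  ∑-+ f g (x ∷ xs) rewrite ∑-+ f g xs = interchange (f x) (g x) (∑ xs f) (∑ xs g)
    where
    interchange : ∀ a b c d → (a + b) + (c + d) ≡ (a + c) + (b + d)
    interchange = solve-∀

  ∑-const : ∀ c (xs : List A) → ∑ xs (λ _ → c) ≡ length xs * c
  ∑-const c []       = refl
  ∑-const c (x ∷ xs) = cong (c +_) (∑-const c xs)

  ∑-++ : ∀ (f : A → ℕ) xs ys → ∑ (xs ++ ys) f ≡ ∑ xs f + ∑ ys f
  ∑-++ f xs ys = trans (cong sum (map-++ f xs ys)) (sum-++ (map f xs) (map f ys))

  ∑-↭ : ∀ (f : A → ℕ) {xs ys} → xs ↭ ys → ∑ xs f ≡ ∑ ys f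
  ∑-↭ f xs↭ys = sum-↭ (map⁺ f xs↭ys)

  ∑-mono-excess : ∀ {f g : A → ℕ} {c x xs} → (∀ y → f y ≤ g y) → x ∈ xs → f x + c ≤ g x →
    ∑ xs f + c ≤ ∑ xs g
  ∑-mono-excess {f} {g} {c} {x} {y ∷ xs} f≤g (here refl) excess = begin
    f x + ∑ xs f + c    ≡⟨ shuffle (f x) (∑ xs f) c ⟩
    f x + c + ∑ xs f    ≤⟨ +-mono-≤ excess (∑-mono xs λ _ → f≤g _) ⟩
    g x + ∑ xs g        ∎
    where
    open ≤-Reasoning
    shuffle : ∀ a b c → a + b + c ≡ a + c + b
    shuffle = solve-∀
  ∑-mono-excess {f} {g} {c} {x} {y ∷ xs} f≤g (there x∈) excess = begin
    f y + ∑ xs f + c    ≡⟨ +-assoc (f y) (∑ xs f) c ⟩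
    f y + (∑ xs f + c)  ≤⟨ +-mono-≤ (f≤g y) (∑-mono-excess f≤g x∈ excess) ⟩
    g y + ∑ xs g        ∎
    where open ≤-Reasoning

∑-swap : ∀ {A B : Set} (f : A → B → ℕ) xs ys →
  ∑ xs (λ x → ∑ ys (f x)) ≡ ∑ ys (λ y → ∑ xs (λ x → f x y))
∑-swap f []       ys = sym (trans (∑-const 0 ys) (*-zeroʳ (length ys)))
∑-swap f (x ∷ xs) ys = trans (cong (∑ ys (f x) +_) (∑-swap f xs ys))
  (sym (∑-+ (f x) (λ y → ∑ xs (λ x → f x y)) ys))

∑-*ʳ : ∀ {A : Set} (f : A → ℕ) c xs → ∑ xs (λ x → f x * c) ≡ ∑ xs f * c
∑-*ʳ f c []       = refl
∑-*ʳ f c (x ∷ xs) = trans (cong (f x * c +_) (∑-*ʳ f c xs)) (sym (*-distribʳ-+ c (f x) (∑ xs f)))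

extract : ∀ {A : Set} {x : A} {xs} → x ∈ xs → ∃ λ ys → xs ↭ x ∷ ys
extract {xs = x ∷ xs} (here refl) = xs , ↭-refl
extract {xs = y ∷ xs} (there x∈) with ys , xs↭ ← extract x∈ =
  y ∷ ys , ↭-trans (prep y xs↭) (swap y _ ↭-refl)

extract₂ : ∀ {A : Set} {x y : A} {xs} → x ∈ xs → y ∈ xs → y ≢ x → ∃ λ zs → xs ↭ x ∷ y ∷ zs
extract₂ x∈ y∈ y≢x with ys , xs↭ ← extract x∈ with ∈-resp-↭ xs↭ y∈
... | here y≡x = contradiction y≡x y≢x
... | there y∈ys with zs , ys↭ ← extract y∈ys = zs , ↭-trans xs↭ (prep _ ys↭)

-- Cuts

χ : Bool → ℕ
χ true  = 1
χ false = 0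

allBool? : ∀ {P : Bool → Set} → Decidable P → Dec (∀ b → P b)
allBool? P? = map′ (λ { (p , q) true → p ; (p , q) false → q }) (λ f → f true , f false)
  (P? true ×-dec P? false)

xor-submodular : ∀ a b c d →
  χ ((a ∧ b) xor (c ∧ d)) + χ ((a ∨ b) xor (c ∨ d)) ≤ χ (a xor c) + χ (b xor d)
xor-submodular = toWitness {a? = allBool? λ a → allBool? λ b → allBool? λ c → allBool? λ d → _ ≤? _} _

cut : ∀ {n} → Subset n → Fin n → Fin n → ℕ
cut S u v = χ (lookup S u xor lookup S v)

cut-submodular : ∀ {n} (S T : Subset n) u v →
  cut (S ∩ T) u v + cut (S ∪ T) u v ≤ cut S u v + cut T u v
cut-submodular S T u v
  rewrite lookup-zipWith _∧_ u S T | lookup-zipWith _∧_ v S T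
        | lookup-zipWith _∨_ u S T | lookup-zipWith _∨_ v S T
  = xor-submodular (lookup S u) (lookup T u) (lookup S v) (lookup T v)

cut-sym : ∀ {n} (S : Subset n) u v → cut S u v ≡ cut S v u
cut-sym S u v with lookup S u | lookup S v
... | true  | true  = refl
... | true  | false = refl
... | false | true  = refl
... | false | false = refl

-- A subset of Fin m stands for a cut of Fin (suc m), represented by its side avoiding zero.
side : ∀ {m} → Subset m → Subset (suc m)
side S = outside ∷ S

module _ {m : ℕ} where

  dist : List (Subset m) → Fin (suc m) → Fin (suc m) → ℕ
  dist L u v = ∑ L (λ S → cut (side S) u v)

  _⊈_ : Subset m → Subset m → Set
  S ⊈ T = ∃ λ x → x Subset.∈ S × x Subset.∉ T

  -- Only three of the four corners of the pair are tested: the fourth, the complement of the union,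
  -- always contains the vertex `zero`.
  Crossing : Subset m → Subset m → Set
  Crossing S T = Nonempty (S ∩ T) × S ⊈ T × T ⊈ S

  crossing? : ∀ S T → Dec (Crossing S T)
  crossing? S T = nonempty? (S ∩ T) ×-dec (S ⊈? T) ×-dec (T ⊈? S)
    where
    _⊈?_ : ∀ S T → Dec (S ⊈ T)
    S ⊈? T = Fin.any? λ x → (x Subset.∈? S) ×-dec ¬? (x Subset.∈? T)

  Laminar : List (Subset m) → Set
  Laminar L = ∀ {S T} → S ∈ L → T ∈ L → ¬ Crossing S T

  -- Uncrossing preserves the sum of the sizes and increases the sum of their squares.
  potential : List (Subset m) → ℕ
  potential L = ∑ L (λ S → ∣ S ∣ * ∣ S ∣)

  potential≤ : ∀ L → potential L ≤ length L * (m * m)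
  potential≤ L = subst (potential L ≤_) (∑-const (m * m) L)
    (∑-mono L (λ {S} _ → *-mono-≤ (∣p∣≤n S) (∣p∣≤n S)))

-- Uncrossing to a laminar family

∣∩∣+∣∪∣ : ∀ {n} (S T : Subset n) → ∣ S ∩ T ∣ + ∣ S ∪ T ∣ ≡ ∣ S ∣ + ∣ T ∣
∣∩∣+∣∪∣ []          []          = refl
∣∩∣+∣∪∣ (true ∷ S)  (true ∷ T)  = cong suc (trans (+-suc _ _) (trans (cong suc (∣∩∣+∣∪∣ S T)) (sym (+-suc _ _))))
∣∩∣+∣∪∣ (true ∷ S)  (false ∷ T) = trans (+-suc _ _) (cong suc (∣∩∣+∣∪∣ S T))
∣∩∣+∣∪∣ (false ∷ S) (true ∷ T)  = trans (+-suc _ _) (trans (cong suc (∣∩∣+∣∪∣ S T)) (sym (+-suc _ _)))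
∣∩∣+∣∪∣ (false ∷ S) (false ∷ T) = ∣∩∣+∣∪∣ S T

-- Writing `s = i + p` and `t = i + q` with `p` and `q` positive gives `u = i + p + q`, and the sums
-- of squares differ by `2 p q`.
squares-spread : ∀ {i u s t} → i + u ≡ s + t → i < s → i < t → s * s + t * t < i * i + u * u
squares-spread {i} {u} eq i<s i<t
  with a , refl ← m≤n⇒∃[o]m+o≡n i<s
     | b , refl ← m≤n⇒∃[o]m+o≡n i<t
  = subst (λ u → (suc i + a) * (suc i + a) + (suc i + b) * (suc i + b) < i * i + u * u)
      (sym (+-cancelˡ-≡ i u _ (trans eq (regroup i a b))))
      (subst (λ z → (suc i + a) * (suc i + a) + (suc i + b) * (suc i + b) < z) (sym (identity i a b))
        (s≤s (m≤m+n ((suc i + a) * (suc i + a) + (suc i + b) * (suc i + b)) _)))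
  where
  regroup : ∀ i a b → (suc i + a) + (suc i + b) ≡ i + (suc i + a + suc b)
  regroup = solve-∀

  identity : ∀ i a b → i * i + (suc i + a + suc b) * (suc i + a + suc b)
    ≡ suc ((suc i + a) * (suc i + a) + (suc i + b) * (suc i + b) + (2 * (a * b + a + b) + 1))
  identity = solve-∀

module _ {m : ℕ} where

  ∩-shrinks : ∀ {S T : Subset m} → S ⊈ T → ∣ S ∩ T ∣ < ∣ S ∣
  ∩-shrinks {S} {T} (x , x∈S , x∉T) = p⊂q⇒∣p∣<∣q∣
    (Subset.p∩q⊆p S T , x , x∈S , λ x∈S∩T → x∉T (Subset.p∩q⊆q S T x∈S∩T))

  uncross-pair : ∀ {L : List (Subset m)} {S T} → All Nonempty L → S ∈ L → T ∈ L → Crossing S T →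
    ∃ λ L′ → All Nonempty L′ × length L′ ≡ length L × (∀ u v → dist L′ u v ≤ dist L u v)
           × potential L < potential L′
  uncross-pair {L} {S} {T} ne S∈ T∈ ((x , x∈S∩T) , S⊈T@(y , y∈S , y∉T) , T⊈S)
    with R , L↭ ← extract₂ S∈ T∈ (λ { refl → y∉T y∈S })
    with _ ∷ _ ∷ neR ← All-resp-↭ L↭ ne
    = S ∩ T ∷ S ∪ T ∷ R
    , (x , x∈S∩T) ∷ (y , Subset.p⊆p∪q T y∈S) ∷ neR
    , sym (↭-length L↭)
    , shorter
    , larger
    where
    open ≤-Reasoning

    shorter : ∀ u v → dist (S ∩ T ∷ S ∪ T ∷ R) u v ≤ dist L u v
    shorter u v = begin
      cut (side (S ∩ T)) u v + (cut (side (S ∪ T)) u v + dist R u v)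
        ≡⟨ +-assoc (cut (side (S ∩ T)) u v) _ _ ⟨
      cut (side (S ∩ T)) u v + cut (side (S ∪ T)) u v + dist R u v
        ≤⟨ +-monoˡ-≤ (dist R u v) (cut-submodular (side S) (side T) u v) ⟩
      cut (side S) u v + cut (side T) u v + dist R u v
        ≡⟨ +-assoc (cut (side S) u v) _ _ ⟩
      dist (S ∷ T ∷ R) u v
        ≡⟨ ∑-↭ (λ S → cut (side S) u v) L↭ ⟨
      dist L u v ∎

    larger : potential L < potential (S ∩ T ∷ S ∪ T ∷ R)
    larger = begin-strict
      potential L
        ≡⟨ ∑-↭ (λ S → ∣ S ∣ * ∣ S ∣) L↭ ⟩
      ∣ S ∣ * ∣ S ∣ + (∣ T ∣ * ∣ T ∣ + potential R)
        ≡⟨ +-assoc (∣ S ∣ * ∣ S ∣) _ _ ⟨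
      ∣ S ∣ * ∣ S ∣ + ∣ T ∣ * ∣ T ∣ + potential R
        <⟨ +-monoˡ-< (potential R) (squares-spread (∣∩∣+∣∪∣ S T) (∩-shrinks {S} {T} S⊈T)
             (subst (_< ∣ T ∣) (cong ∣_∣ (Subset.∩-comm T S)) (∩-shrinks {T} {S} T⊈S))) ⟩
      ∣ S ∩ T ∣ * ∣ S ∩ T ∣ + ∣ S ∪ T ∣ * ∣ S ∪ T ∣ + potential R
        ≡⟨ +-assoc (∣ S ∩ T ∣ * ∣ S ∩ T ∣) _ _ ⟩
      potential (S ∩ T ∷ S ∪ T ∷ R) ∎

  crossing-pair? : ∀ (L : List (Subset m)) → Laminar L ⊎ ∃₂ λ S T → S ∈ L × T ∈ L × Crossing S T
  crossing-pair? L with Any.any? (λ S → Any.any? (crossing? S) L) L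
  ... | no none = inj₁ λ S∈ T∈ cross → none (lose S∈ (lose T∈ cross))
  ... | yes some with S , S∈ , someT ← find some with T , T∈ , cross ← find someT =
    inj₂ (S , T , S∈ , T∈ , cross)

  uncross : ∀ (L : List (Subset m)) → All Nonempty L →
    ∃ λ L′ → All Nonempty L′ × length L′ ≡ length L × (∀ u v → dist L′ u v ≤ dist L u v) × Laminar L′
  -- Uncrossing keeps the length, so `length L * (m * m)` bounds the potential of every family
  -- reached, and the fuel only has to cover the distance to that bound.
  uncross L ne = go (length L * (m * m)) L ne (m≤n+m _ (potential L))
    where
    open ≤-Reasoning

    go : ∀ fuel L → All Nonempty L → length L * (m * m) ≤ potential L + fuel →
      ∃ λ L′ → All Nonempty L′ × length L′ ≡ length L × (∀ u v → dist L′ u v ≤ dist L u v) × Laminar L′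
    go fuel L ne enough with crossing-pair? L
    ... | inj₁ laminar = L , ne , refl , (λ u v → ≤-refl) , laminar
    ... | inj₂ (S , T , S∈ , T∈ , cross)
      with L′ , ne′ , len′ , shorter , larger ← uncross-pair ne S∈ T∈ cross
      with fuel
    ...   | zero = contradiction (begin-strict
        length L * (m * m)    ≤⟨ enough ⟩
        potential L + 0       ≡⟨ +-identityʳ _ ⟩
        potential L           <⟨ larger ⟩
        potential L′          ≤⟨ potential≤ L′ ⟩
        length L′ * (m * m)   ≡⟨ cong (_* (m * m)) len′ ⟩
        length L * (m * m)    ∎) (<-irrefl refl)
    ...   | suc fuel with L″ , ne″ , len″ , shorter′ , laminar ← go fuel L′ ne′ (begin
        length L′ * (m * m)     ≡⟨ cong (_* (m * m)) len′ ⟩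
        length L * (m * m)      ≤⟨ enough ⟩
        potential L + suc fuel  ≡⟨ +-suc (potential L) fuel ⟩
        suc (potential L) + fuel ≤⟨ +-monoˡ-≤ fuel larger ⟩
        potential L′ + fuel     ∎)
      = L″ , ne″ , trans len″ len′ , (λ u v → ≤-trans (shorter′ u v) (shorter u v)) , laminar

  -- The four-point condition at the root

  Separates : Fin (suc m) → Fin (suc m) → Fin (suc m) → Subset m → Set
  Separates v b a S = lookup (side S) v ≡ true × lookup (side S) b ≡ true × lookup (side S) a ≡ false

  separates? : ∀ v b a S → Dec (Separates v b a S)
  separates? v b a S = (lookup (side S) v Bool.≟ true) ×-dec (lookup (side S) b Bool.≟ true)
    ×-dec (lookup (side S) a Bool.≟ false)

  separates-crossing : ∀ {v a b S T} → Separates v b a S → Separates v a b T → Crossing S T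
  separates-crossing {suc v} {suc a} {suc b} {S} {T} (v∈S , b∈S , a∉S) (v∈T , a∈T , b∉T) =
    (v , Subset.x∈p∩q⁺ (lookup⇒[]= v S v∈S , lookup⇒[]= v T v∈T))
    , (b , lookup⇒[]= b S b∈S , λ b∈T → case-⊥ (trans (sym b∉T) ([]=⇒lookup b∈T)))
    , (a , lookup⇒[]= a T a∈T , λ a∈S → case-⊥ (trans (sym a∉S) ([]=⇒lookup a∈S)))
    where
    case-⊥ : false ≢ true
    case-⊥ ()

  -- The inequality holds cut by cut with one exception: a side containing `v` and `b` but not `a`
  -- contributes 2 on the left and 0 on the right. This is the pattern `Separates v b a`.
  one-sided : ∀ {L : List (Subset m)} v a b → (∀ {S} → S ∈ L → ¬ Separates v b a S) →
    dist L zero v + dist L a b ≤ dist L zero a + dist L v b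
  one-sided {L} v a b none = subst₂ _≤_
    (∑-+ (λ S → cut (side S) zero v) (λ S → cut (side S) a b) L)
    (∑-+ (λ S → cut (side S) zero a) (λ S → cut (side S) v b) L)
    (∑-mono L λ {S} S∈ → pointwise (lookup (side S) v) (lookup (side S) a) (lookup (side S) b) (none S∈))
    where
    pointwise : ∀ x y z → ¬ (x ≡ true × z ≡ true × y ≡ false) →
      χ x + χ (y xor z) ≤ χ y + χ (x xor z)
    pointwise = toWitness {a? = allBool? λ x → allBool? λ y → allBool? λ z →
      ¬? ((x Bool.≟ true) ×-dec (z Bool.≟ true) ×-dec (y Bool.≟ false)) →-dec (_ ≤? _)} _

  -- A side with `v` and `b` but not `a` crosses any side with `v` and `a` but not `b`. A laminar
  -- family contains at most one of these two exceptional patterns, so at least one of the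
  -- inequalities holds cut by cut.
  four-point : ∀ {L : List (Subset m)} → Laminar L → ∀ v a b →
    (dist L zero v + dist L a b ≤ dist L zero a + dist L v b) ⊎
    (dist L zero v + dist L b a ≤ dist L zero b + dist L v a)
  four-point {L} laminar v a b with Any.any? (separates? v b a) L
  ... | no none  = inj₁ (one-sided v a b λ S∈ sep → none (lose S∈ sep))
  ... | yes some with S , S∈ , sepS ← find some =
    inj₂ (one-sided v b a λ T∈ sepT → laminar S∈ T∈ (separates-crossing {v} {a} {b} sepS sepT))

  dist-sym : ∀ (L : List (Subset m)) u v → dist L u v ≡ dist L v u
  dist-sym L u v = ∑-cong (λ S → cut-sym (side S) u v) L

-- Rotations of a cyclic index set

module _ {k : ℕ} where

  rotate : ℕ → Fin k → Fin k
  rotate zero    i = i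
  rotate (suc t) i = sucMod (rotate t i)

  toℕ-sucMod : ∀ (i : Fin k) → ∃ λ c → suc (toℕ i) ≡ toℕ (sucMod i) + c * k
  toℕ-sucMod i = (suc (toℕ i) / k) {{nonZeroIndex i}} ,
    trans (m≡m%n+[m/n]*n (suc (toℕ i)) k {{nonZeroIndex i}})
      (cong (_+ ((suc (toℕ i) / k) {{nonZeroIndex i}}) * k)
        (sym (toℕ-fromℕ< (m%n<n (suc (toℕ i)) k {{nonZeroIndex i}}))))

  toℕ-rotate : ∀ t (i : Fin k) → ∃ λ c → t + toℕ i ≡ toℕ (rotate t i) + c * k
  toℕ-rotate zero i = 0 , sym (+-identityʳ (toℕ i))
  toℕ-rotate (suc t) i
    with c , eq ← toℕ-rotate t i
       | d , eq′ ← toℕ-sucMod (rotate t i) = d + c , (begin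
    suc (t + toℕ i)                              ≡⟨ cong suc eq ⟩
    suc (toℕ (rotate t i)) + c * k               ≡⟨ cong (_+ c * k) eq′ ⟩
    toℕ (sucMod (rotate t i)) + d * k + c * k    ≡⟨ collect (toℕ (sucMod (rotate t i))) d c k ⟩
    toℕ (sucMod (rotate t i)) + (d + c) * k      ∎)
    where
    open ≡-Reasoning
    collect : ∀ a d c k → a + d * k + c * k ≡ a + (d + c) * k
    collect = solve-∀

  -- A fixed index would make `suc t` a multiple of `k`, although it lies strictly between 0 and
  -- `k`.
  rotate-≢ : ∀ t {i : Fin k} → suc t < k → rotate (suc t) i ≢ i
  rotate-≢ t {i} t<k fixed with c , eq ← toℕ-rotate (suc t) i
    with c | +-cancelʳ-≡ (toℕ i) (suc t) (c * k)
               (trans eq (trans (cong (λ j → toℕ j + c * k) fixed) (+-comm (toℕ i) (c * k))))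
  ... | suc c | t≡ = <-irrefl t≡ (<-≤-trans t<k (m≤m+n k (c * k)))

  rotate-reaches : ∀ i j → ∃ λ t → rotate t i ≡ j
  -- Going to the end of the lap and then on to `j` avoids a truncated `toℕ j ∸ toℕ i` when `j`
  -- comes before `i`.
  rotate-reaches i j with c , eq ← toℕ-rotate (toℕ j + (k ∸ toℕ i)) i = toℕ j + (k ∸ toℕ i) ,
    toℕ-injective (begin
      toℕ (rotate t i)                   ≡⟨ m<n⇒m%n≡m (toℕ<n (rotate t i)) ⟨
      toℕ (rotate t i) % k               ≡⟨ [m+kn]%n≡m%n (toℕ (rotate t i)) c k ⟨
      (toℕ (rotate t i) + c * k) % k     ≡⟨ cong (_% k) eq ⟨
      (toℕ j + (k ∸ toℕ i) + toℕ i) % k  ≡⟨ cong (_% k) (trans (+-assoc (toℕ j) _ _)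
                                              (cong (toℕ j +_) (trans (m∸n+n≡m (<⇒≤ (toℕ<n i))) (sym (+-identityʳ k))))) ⟩
      (toℕ j + 1 * k) % k                ≡⟨ [m+kn]%n≡m%n (toℕ j) 1 k ⟩
      toℕ j % k                          ≡⟨ m<n⇒m%n≡m (toℕ<n j) ⟩
      toℕ j                              ∎)
    where
    open ≡-Reasoning
    t = toℕ j + (k ∸ toℕ i)
    instance
      k≢0 : NonZero k
      k≢0 = nonZeroIndex i

  sucMod-surjective : ∀ i → ∃ λ j → sucMod j ≡ i
  sucMod-surjective i with rotate-reaches (sucMod i) i
  ... | zero  , eq = i , eq
  ... | suc t , eq = rotate t (sucMod i) , eq

  descent : ∀ (g : Fin k → Bool) b {i j} → g i ≡ b → g j ≢ b →
    ∃ λ p → g p ≡ b × g (sucMod p) ≢ b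
  descent g b {i} {j} gi≡b gj≢b
    with Fin.any? (λ p → (g p Bool.≟ b) ×-dec ¬? (g (sucMod p) Bool.≟ b))
  ... | yes found = found
  ... | no  none with t , reach ← rotate-reaches i j =
    contradiction (trans (cong g (sym reach)) (constant t)) gj≢b
    where
    constant : ∀ t → g (rotate t i) ≡ b
    constant zero    = gi≡b
    constant (suc t) with g (sucMod (rotate t i)) Bool.≟ b
    ... | yes eq = eq
    ... | no neq = contradiction (rotate t i , constant t , neq) none

  -- Going around, `g` must drop from true to false somewhere and rise from false to true somewhere.
  -- The two positions differ because `g` has different values there.
  two-changes : ∀ (g : Fin k → Bool) {i j} → g i ≡ true → g j ≡ false →
    2 ≤ ∑ (allFin k) (λ p → χ (g p xor g (sucMod p)))
  two-changes g {i} {j} gi gj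
    with p , gp , gp′ ← descent g true {i} {j} gi (λ eq → contradiction (trans (sym eq) gj) λ ())
       | q , gq , gq′ ← descent g false {j} {i} gj (λ eq → contradiction (trans (sym gi) eq) λ ())
    with zs , perm ← extract₂ (∈-allFin p) (∈-allFin q)
                       (λ { refl → contradiction (trans (sym gp) gq) λ () })
    = subst (2 ≤_) (sym (∑-↭ change perm))
        (+-mono-≤ (≤-reflexive (sym (changed gp gp′))) (+-mono-≤ (≤-reflexive (sym (changed gq gq′))) z≤n))
    where
    change : Fin k → ℕ
    change p = χ (g p xor g (sucMod p))

    changed : ∀ {x y b} → x ≡ b → y ≢ b → χ (x xor y) ≡ 1
    changed {true}  {true}  refl neq = contradiction refl neq
    changed {true}  {false} refl neq = refl
    changed {false} {true}  refl neq = refl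
    changed {false} {false} refl neq = contradiction refl neq

-- The threshold graph of a family of cuts

module _ {m : ℕ} (L : List (Subset m)) (d : ℕ) where

  Near : Fin (suc m) → Fin (suc m) → Set
  Near u v = u ≢ v × dist L u v ≤ d

  near? : ∀ u v → Dec (Near u v)
  near? u v = ¬? (u Fin.≟ v) ×-dec (dist L u v ≤? d)

  near-sym : ∀ {u v} → Near u v → Near v u
  near-sym {u} {v} (u≢v , close) = ≢-sym u≢v , subst (_≤ d) (dist-sym L u v) close

  threshold : Graph (suc m)
  threshold = record
    { adj    = λ u v → isYes (near? u v)
    ; symm   = λ u v → trans (isYes≗does (near? u v))
        (trans (does-⇔ (mk⇔ near-sym near-sym) (near? u v) (near? v u)) (sym (isYes≗does (near? v u))))
    ; irrefl = λ v → trans (isYes≗does (near? v v)) (dec-false (near? v v) λ (v≢v , _) → v≢v refl)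
    }

  adj⇒near : ∀ {u v} → Adj threshold u v → Near u v
  adj⇒near {u} {v} = toWitness {a? = near? u v}

  near⇒adj : ∀ {u v} → Near u v → Adj threshold u v
  near⇒adj {u} {v} = fromWitness {a? = near? u v}

  -- If v is a vertex of the cycle farthest from the root zero, the four-point condition for zero, v
  -- and the neighbours a, b of v on the cycle shows that ab is a chord.
  farthest-has-chord : Laminar L → ∀ {k} → 4 ≤ k → (C : Cycle threshold k) → ∀ p →
    (∀ j → dist L zero (Cycle.vertex C j) ≤ dist L zero (Cycle.vertex C (sucMod p))) → ¬ Induced C
  farthest-has-chord laminar {k} 4≤k C p highest induced = no-chord (induced p s (near⇒adj (a≢b , ab≤d)))
    where
    open Cycle C

    i s : Fin k
    i = sucMod p
    s = sucMod i

    v a b : Fin (suc m)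
    v = vertex i
    a = vertex p
    b = vertex s

    va≤d : dist L v a ≤ d
    va≤d = proj₂ (near-sym (adj⇒near (adjacent p)))

    vb≤d : dist L v b ≤ d
    vb≤d = proj₂ (adj⇒near (adjacent i))

    ab≤d : dist L a b ≤ d
    ab≤d with four-point {L = L} laminar v a b
    ... | inj₁ le = +-cancelˡ-≤ (dist L zero v) _ _ (≤-trans le (+-mono-≤ (highest p) vb≤d))
    ... | inj₂ le = subst (_≤ d) (dist-sym L b a)
                      (+-cancelˡ-≤ (dist L zero v) _ _ (≤-trans le (+-mono-≤ (highest s) va≤d)))

    a≢b : a ≢ b
    a≢b a≡b = rotate-≢ 1 (≤-trans (s≤s (s≤s (s≤s z≤n))) 4≤k) (sym (injective a≡b))

    -- Length at least four is needed for the second alternative, which says that three steps from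
    -- `p` lead back to `p`.
    no-chord : ¬ (s ≡ sucMod p ⊎ p ≡ sucMod s)
    no-chord (inj₁ s≡i) = rotate-≢ 0 (≤-trans (s≤s (s≤s z≤n)) 4≤k) s≡i
    no-chord (inj₂ p≡)  = rotate-≢ 2 4≤k (sym p≡)

  threshold-chordal : Laminar L → Chordal threshold
  threshold-chordal laminar k 4≤k C =
    farthest-has-chord laminar 4≤k C (proj₁ before) λ j → subst (λ i → height j ≤ height i) (sym (proj₂ before))
      (All.lookup (Extrema.f[xs]≤f[argmax] {f = height} 0th (allFin k)) (∈-allFin j))
    where
    0th : Fin k
    0th = fromℕ< (≤-trans (s≤s z≤n) 4≤k)

    height : Fin k → ℕ
    height j = dist L zero (Cycle.vertex C j)

    -- The farthest vertex is named through its predecessor, so that both of its neighbours on the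
    -- cycle are written with `sucMod` alone.
    before : ∃ λ p → sucMod p ≡ Extrema.argmax height 0th (allFin k)
    before = sucMod-surjective (Extrema.argmax height 0th (allFin k))

  threshold-non-Hamiltonian : All Nonempty L → suc m * d < 2 * length L → ¬ Hamiltonian threshold
  threshold-non-Hamiltonian nonempty violated (k , C , covers) = <-irrefl refl (begin-strict
    suc m * d
      <⟨ violated ⟩
    2 * length L
      ≡⟨ *-comm 2 (length L) ⟩
    length L * 2
      ≡⟨ ∑-const 2 L ⟨
    ∑ L (λ _ → 2)
      ≤⟨ ∑-mono L crossed-twice ⟩
    ∑ L (λ S → ∑ (allFin k) λ i → cut (side S) (vertex i) (vertex (sucMod i)))
      ≡⟨ ∑-swap (λ S i → cut (side S) (vertex i) (vertex (sucMod i))) L (allFin k) ⟩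
    ∑ (allFin k) (λ i → dist L (vertex i) (vertex (sucMod i)))
      ≤⟨ ∑-mono (allFin k) (λ {i} _ → proj₂ (adj⇒near (adjacent i))) ⟩
    ∑ (allFin k) (λ _ → d)
      ≡⟨ ∑-const d (allFin k) ⟩
    length (allFin k) * d
      ≡⟨ cong (_* d) (length-tabulate {n = k} id) ⟩
    k * d
      ≤⟨ *-monoˡ-≤ d (injective⇒≤ injective) ⟩
    suc m * d ∎)
    where
    open Cycle C
    open ≤-Reasoning

    -- The cycle visits a vertex of the nonempty side and also `zero`, which lies outside every
    -- side.
    crossed-twice : ∀ {S} → S ∈ L →
      2 ≤ ∑ (allFin k) (λ i → cut (side S) (vertex i) (vertex (sucMod i)))
    crossed-twice {S} S∈ with x , x∈S ← All.lookup nonempty S∈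
      with i , vi≡x ← covers (suc x) | j , vj≡0 ← covers zero =
      two-changes (λ i → lookup (side S) (vertex i))
        (trans (cong (lookup (side S)) vi≡x) ([]=⇒lookup x∈S))
        (cong (lookup (side S)) vj≡0)

-- Enumerations

module _ {A B : Set} (g : A → Maybe B) where

  ∈-mapMaybe : ∀ {a b xs} → a ∈ xs → g a ≡ just b → b ∈ mapMaybe g xs
  ∈-mapMaybe {a} (here refl) eq with g a
  ∈-mapMaybe     (here refl) refl | just _ = here refl
  ∈-mapMaybe {xs = x ∷ _} (there a∈) eq with g x
  ... | just _  = there (∈-mapMaybe a∈ eq)
  ... | nothing = ∈-mapMaybe a∈ eq

  module _ (key : B → A) (key-g : ∀ {a b} → g a ≡ just b → key b ≡ a) where

    mapMaybe-avoids : ∀ {a b xs} → g a ≡ just b → All (a ≢_) xs → All (b ≢_) (mapMaybe g xs)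
    mapMaybe-avoids ga [] = []
    mapMaybe-avoids {xs = x ∷ xs} ga (a≢x ∷ a∉xs) with g x in gx
    ... | nothing = mapMaybe-avoids ga a∉xs
    ... | just c  = (λ { refl → a≢x (trans (sym (key-g ga)) (key-g gx)) }) ∷ mapMaybe-avoids ga a∉xs

    mapMaybe-unique : ∀ {xs} → Unique xs → Unique (mapMaybe g xs)
    mapMaybe-unique [] = []
    mapMaybe-unique {x ∷ xs} (x∉xs ∷ u) with g x in gx
    ... | nothing = mapMaybe-unique u
    ... | just b  = mapMaybe-avoids gx x∉xs ∷ mapMaybe-unique u

subsets : ∀ n → List (Subset n)
subsets zero    = [ [] ]
subsets (suc n) = map (inside ∷_) (subsets n) ++ map (outside ∷_) (subsets n)

∈-subsets : ∀ {n} (S : Subset n) → S ∈ subsets n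
∈-subsets []          = here refl
∈-subsets (true ∷ S)  = ∈-++⁺ˡ (∈-map⁺ (inside ∷_) (∈-subsets S))
∈-subsets (false ∷ S) = ∈-++⁺ʳ (map (inside ∷_) (subsets _)) (∈-map⁺ (outside ∷_) (∈-subsets S))

module _ {n : ℕ} (G : Graph n) where
  open Edge

  endpoints : Edge G → Fin n × Fin n
  endpoints e = src e , tgt e

  -- Agrees definitionally with the function local to edges in Defs.
  edge? : Fin n × Fin n → Maybe (Edge G)
  edge? (u , v) = Maybe.map (λ (u<v , uv) → mkEdge u v u<v uv)
    (dec⇒maybe ((u Fin.<? v) ×-dec Bool.T? (Graph.adj G u v)))

  edge-≡ : ∀ {e e′ : Edge G} → src e ≡ src e′ → tgt e ≡ tgt e′ → e ≡ e′
  edge-≡ {mkEdge u v p q} {mkEdge u v p′ q′} refl refl =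
    cong₂ (mkEdge u v) (Fin.<-irrelevant p p′) (Bool.T-irrelevant q q′)

  _≟ᴱ_ : DecidableEquality (Edge G)
  e ≟ᴱ e′ with src e Fin.≟ src e′ | tgt e Fin.≟ tgt e′
  ... | yes p | yes q = yes (edge-≡ p q)
  ... | no ¬p | _     = no λ { refl → ¬p refl }
  ... | _     | no ¬q = no λ { refl → ¬q refl }

  edge?-endpoints : ∀ {p e} → edge? p ≡ just e → endpoints e ≡ p
  edge?-endpoints {u , v} eq with (u Fin.<? v) ×-dec Bool.T? (Graph.adj G u v)
  edge?-endpoints refl | yes _ = refl

  edge?-complete : ∀ e → edge? (endpoints e) ≡ just e
  edge?-complete e with (src e Fin.<? tgt e) ×-dec Bool.T? (Graph.adj G (src e) (tgt e))
  ... | yes _  = cong just (edge-≡ refl refl)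
  ... | no ¬uv = contradiction (src<tgt e , adjacent e) ¬uv

  ∈-edges : ∀ e → e ∈ edges G
  ∈-edges e = ∈-mapMaybe edge? (∈-cartesianProduct⁺ (∈-allFin (src e)) (∈-allFin (tgt e))) (edge?-complete e)

  edges-unique : Unique (edges G)
  edges-unique = mapMaybe-unique edge? endpoints edge?-endpoints
    (Unique.cartesianProduct⁺ (Unique.allFin⁺ n) (Unique.allFin⁺ n))

-- Linear programming duality for fractional Hamiltonian cycles

module _ {m : ℕ} (G : Graph (suc m)) where
  open Edge
  open import Data.Integer.Base using (+_)

  private n = suc m

  cutᴱ : Subset n → Edge G → ℕ
  cutᴱ S e = cut S (src e) (tgt e)

  -- A fractional Hamiltonian cycle y / d; the constraints y ≤ d and n d ≤ Σ y follow from the others.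
  ScaledCycle : (Edge G → ℕ) → ℕ → Set
  ScaledCycle y d = 0 < d × ∑ (edges G) y ≤ n * d ×
    (∀ S → Nonempty S → 2 * d ≤ ∑ (edges G) λ e → cutᴱ (side S) e * y e)

  CutPacking : List (Subset m) → ℕ → Set
  CutPacking L k = All Nonempty L × (∀ (e : Edge G) → dist L (src e) (tgt e) ≤ k) × n * k < 2 * length L

  -- A nonnegative integral combination of the constraints: repetition in `cuts` is the multiplicity
  -- of a cut constraint, `bound` that of the total constraint. Any refutation over this type is
  -- thus a family of nonempty cuts with a number, with no derivation left to decode.
  record Combination : Set where
    constructor combination
    field
      cuts     : List (Subset m)
      nonempty : All Nonempty cuts
      bound    : ℕ
  open Combination

  -- The row of (L , k) is the inequality k Σ y + 2 |L| d ≤ Σ_S∈L y(∂ S) + k n d.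
  positive negative : Combination → Maybe (Edge G) → ℕ
  positive r (just e) = dist (cuts r) (src e) (tgt e)
  positive r nothing  = n * bound r
  negative r (just e) = bound r
  negative r nothing  = 2 * length (cuts r)

  private
    regroup : ∀ a b c d → (a ℤ.+ b) ℤ.- (c ℤ.+ d) ≡ (a ℤ.- c) ℤ.+ (b ℤ.- d)
    regroup = ℤSolver.solve-∀

  rows : Farkas.RowMonoid (Maybe (Edge G))
  rows = record
    { Row    = Combination
    ; ε      = combination [] [] 0
    ; _⊕_    = _⊕_
    ; coef   = λ r j → + positive r j ℤ.- + negative r j
    ; coef-ε = λ { (just e) → refl ; nothing → cong (λ z → + z ℤ.- + 0) (*-zeroʳ n) }
    ; coef-⊕ = λ r s j → trans (cong₂ (λ a b → + a ℤ.- + b) (positive-⊕ r s j) (negative-⊕ r s j))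
        (regroup (+ positive r j) (+ positive s j) (+ negative r j) (+ negative s j))
    }
    where
    _⊕_ : Combination → Combination → Combination
    combination L ne k ⊕ combination L′ ne′ k′ = combination (L ++ L′) (All.++⁺ ne ne′) (k + k′)

    positive-⊕ : ∀ r s j → positive (r ⊕ s) j ≡ positive r j + positive s j
    positive-⊕ r s (just e) = ∑-++ (λ S → cut (side S) (src e) (tgt e)) (cuts r) (cuts s)
    positive-⊕ r s nothing  = *-distribˡ-+ n (bound r) (bound s)

    negative-⊕ : ∀ r s j → negative (r ⊕ s) j ≡ negative r j + negative s j
    negative-⊕ r s (just e) = refl
    negative-⊕ r s nothing  = trans (cong (2 *_) (length-++ (cuts r)))
      (*-distribˡ-+ 2 (length (cuts r)) (length (cuts s)))

  total-row : Combination
  total-row = combination [] [] 1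

  cut-row : ∀ {S} → Nonempty S → Combination
  cut-row {S} ne = combination [ S ] (ne ∷ []) 0

  cut-row? : Subset m → Maybe Combination
  cut-row? S = Maybe.map cut-row (dec⇒maybe (nonempty? S))

  system : List Combination
  system = total-row ∷ mapMaybe cut-row? (subsets m)

  -- The witness is existential because `system` contains the one computed by `nonempty?`, which may
  -- name another element of `S`.
  cut-row∈ : ∀ {S} → Nonempty S → ∃ λ ne → cut-row {S} ne ∈ system
  cut-row∈ {S} ne with nonempty? S in eq
  ... | yes ne′ = ne′ , there (∈-mapMaybe cut-row? (∈-subsets S) (cong (λ d → Maybe.map cut-row (dec⇒maybe d)) eq))
  ... | no ¬ne  = contradiction ne ¬ne

  variables : List (Maybe (Edge G))
  variables = map just (edges G)

  module _ (x : Maybe (Edge G) → ℤ) (0≤x : ∀ j → ℤ.0ℤ ℤ.≤ x j) where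

    private
      y : Edge G → ℕ
      y e = ℤ.∣ x (just e) ∣

      d : ℕ
      d = ℤ.∣ x nothing ∣

    -- One side of a row's inequality. Since a solution is nonnegative, its absolute values may
    -- replace it, and separating positive from negative coefficients moves the inequality to the
    -- natural numbers.
    evaluate : (Maybe (Edge G) → ℕ) → List (Edge G) → ℕ
    evaluate c es = ∑ es (λ e → c (just e) * y e) + c nothing * d

    scale : ∀ p q j → (+ p ℤ.- + q) ℤ.* x j ≡ + (p * ℤ.∣ x j ∣) ℤ.- + (q * ℤ.∣ x j ∣)
    scale p q j = begin
      (+ p ℤ.- + q) ℤ.* x j
        ≡⟨ cong ((+ p ℤ.- + q) ℤ.*_) (sym (ℤ.0≤i⇒+∣i∣≡i (0≤x j))) ⟩
      (+ p ℤ.- + q) ℤ.* + ℤ.∣ x j ∣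
        ≡⟨ distrib (+ p) (+ q) (+ ℤ.∣ x j ∣) ⟩
      + p ℤ.* + ℤ.∣ x j ∣ ℤ.- + q ℤ.* + ℤ.∣ x j ∣
        ≡⟨ cong₂ ℤ._-_ (ℤ.pos-* p ℤ.∣ x j ∣) (ℤ.pos-* q ℤ.∣ x j ∣) ⟨
      + (p * ℤ.∣ x j ∣) ℤ.- + (q * ℤ.∣ x j ∣) ∎
      where
      open ≡-Reasoning
      distrib : ∀ a b c → (a ℤ.- b) ℤ.* c ≡ a ℤ.* c ℤ.- b ℤ.* c
      distrib = ℤSolver.solve-∀

    eval-rows : ∀ r es → Farkas.eval (≡-dec (_≟ᴱ_ G)) nothing rows (map just es) x r
      ≡ + evaluate (positive r) es ℤ.- + evaluate (negative r) es
    eval-rows r [] = scale (positive r nothing) (negative r nothing) nothing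
    eval-rows r (e ∷ es) = begin
      (+ p ℤ.- + q) ℤ.* x (just e) ℤ.+ Farkas.eval (≡-dec (_≟ᴱ_ G)) nothing rows (map just es) x r
        ≡⟨ cong₂ ℤ._+_ (scale p q (just e)) (eval-rows r es) ⟩
      (+ (p * y e) ℤ.- + (q * y e)) ℤ.+ (+ evaluate (positive r) es ℤ.- + evaluate (negative r) es)
        ≡⟨ regroup (+ (p * y e)) (+ evaluate (positive r) es) (+ (q * y e)) (+ evaluate (negative r) es) ⟨
      + (p * y e + evaluate (positive r) es) ℤ.- + (q * y e + evaluate (negative r) es)
        ≡⟨ cong₂ (λ a b → + a ℤ.- + b) (+-assoc (p * y e) _ _) (+-assoc (q * y e) _ _) ⟨
      + evaluate (positive r) (e ∷ es) ℤ.- + evaluate (negative r) (e ∷ es) ∎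
      where
      open ≡-Reasoning
      p q : ℕ
      p = positive r (just e)
      q = negative r (just e)

    row-holds : ∀ r → ℤ.0ℤ ℤ.≤ Farkas.eval (≡-dec (_≟ᴱ_ G)) nothing rows variables x r →
      evaluate (negative r) (edges G) ≤ evaluate (positive r) (edges G)
    row-holds r 0≤ = ℤ.drop‿+≤+ (ℤ.0≤i-j⇒j≤i (subst (ℤ.0ℤ ℤ.≤_) (eval-rows r (edges G)) 0≤))

  solution⇒scaled : Farkas.Solvable (≡-dec (_≟ᴱ_ G)) nothing rows variables system →
    ∃₂ ScaledCycle
  solution⇒scaled (x , 0≤x , 0<x , sat) = y , d
    , ℤ.drop‿+<+ (subst (ℤ.0ℤ ℤ.<_) (sym (ℤ.0≤i⇒+∣i∣≡i (0≤x nothing))) 0<x)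
    , total
    , λ S ne → let ne′ , row∈ = cut-row∈ ne in cuts≥2 ne′ row∈
    where
    y : Edge G → ℕ
    y e = ℤ.∣ x (just e) ∣

    d : ℕ
    d = ℤ.∣ x nothing ∣

    open ≤-Reasoning

    es = edges G

    zeros : ∑ es (λ e → 0 * y e) ≡ 0
    zeros = trans (∑-const 0 es) (*-zeroʳ (length es))

    total : ∑ es y ≤ n * d
    total = begin
      ∑ es y                             ≡⟨ ∑-cong (λ e → sym (*-identityˡ (y e))) es ⟩
      ∑ es (λ e → 1 * y e)               ≡⟨ +-identityʳ _ ⟨
      ∑ es (λ e → 1 * y e) + 0 * d       ≤⟨ row-holds x 0≤x total-row (sat (here refl)) ⟩
      ∑ es (λ e → 0 * y e) + n * 1 * d   ≡⟨ cong₂ _+_ zeros (cong (_* d) (*-identityʳ n)) ⟩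
      n * d                              ∎

    cuts≥2 : ∀ {S} (ne : Nonempty S) → cut-row {S} ne ∈ system →
      2 * d ≤ ∑ es λ e → cutᴱ (side S) e * y e
    cuts≥2 {S} ne row∈ = begin
      2 * d                                        ≡⟨ cong (_+ 2 * d) zeros ⟨
      ∑ es (λ e → 0 * y e) + 2 * d                 ≤⟨ row-holds x 0≤x (cut-row ne) (sat row∈) ⟩
      ∑ es (λ e → (cutᴱ (side S) e + 0) * y e) + n * 0 * d
        ≡⟨ cong₂ _+_
             (∑-cong {f = λ e → (cutᴱ (side S) e + 0) * y e}
               (λ e → cong (_* y e) (+-identityʳ (cutᴱ (side S) e))) es)
             (cong (_* d) (*-zeroʳ n)) ⟩
      ∑ es (λ e → cutᴱ (side S) e * y e) + 0       ≡⟨ +-identityʳ _ ⟩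
      ∑ es (λ e → cutᴱ (side S) e * y e)           ∎

  -- The coefficient of an edge is its number of cuts minus `k`, and the constant term is `n k`
  -- minus twice the number of cuts, so the signs in a refutation are the packing conditions.
  refutation⇒packing : Farkas.Refutable (≡-dec (_≟ᴱ_ G)) nothing rows variables → ∃₂ CutPacking
  refutation⇒packing (combination L ne k , coef≤0 , const<0) = L , k , ne
    , (λ e → ℤ.drop‿+≤+ (ℤ.i-j≤0⇒i≤j (coef≤0 (∈-map⁺ just (∈-edges G e)))))
    , ℤ.drop‿+<+ (ℤ.≰⇒> λ le → ℤ.<⇒≱ const<0 (ℤ.i≤j⇒0≤j-i le))

  duality : ∃₂ ScaledCycle ⊎ ∃₂ CutPacking
  duality = Sum.map solution⇒scaled refutation⇒packing
    (Farkas.farkas (≡-dec (_≟ᴱ_ G)) nothing rows variables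
      (All.map⁺ (All.universal (λ _ ()) (edges G)) ∷ Unique.map⁺ just-injective (edges-unique G)) system)

-- Cuts of small sets

lookup-⁅⁆-≢ : ∀ {n} {u v : Fin n} → u ≢ v → lookup ⁅ u ⁆ v ≡ false
lookup-⁅⁆-≢ {u = u} {v} u≢v with lookup ⁅ u ⁆ v in eq
... | false = refl
... | true  = contradiction (sym (Subset.x∈⁅y⁆⇒x≡y u (lookup⇒[]= v ⁅ u ⁆ eq))) u≢v

lookup-⁅⁆ : ∀ {n} (u : Fin n) → lookup ⁅ u ⁆ u ≡ true
lookup-⁅⁆ u = []=⇒lookup (Subset.x∈⁅x⁆ u)

small⇒proper : ∀ {n} {S : Subset n} → ∣ S ∣ < n → S ⊂ ⊤
small⇒proper {n} {S} ∣S∣<n with Fin.any? (λ x → Bool.T? (not (lookup S x)))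
... | yes (x , x∉S) = (λ _ → Subset.∈⊤) , x , Subset.∈⊤ ,
  λ x∈S → subst (λ b → T (not b)) ([]=⇒lookup x∈S) x∉S
... | no all∈ = contradiction (begin-strict
  ∣ S ∣  <⟨ ∣S∣<n ⟩
  n      ≡⟨ Subset.∣⊤∣≡n n ⟨
  ∣ ⊤ {n} ∣ ≤⟨ Subset.p⊆q⇒∣p∣≤∣q∣ {p = ⊤} {q = S} (λ {x} _ → member x) ⟩
  ∣ S ∣  ∎) (<-irrefl refl)
  where
  open ≤-Reasoning
  member : ∀ x → x Subset.∈ S
  member x with lookup S x in eq
  ... | true  = lookup⇒[]= x S eq
  ... | false = contradiction (x , subst (λ b → T (not b)) (sym eq) _) all∈

cut-∁ : ∀ {n} (S : Subset n) u v → cut (∁ S) u v ≡ cut S u v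
cut-∁ S u v rewrite lookup-map u not S | lookup-map v not S with lookup S u | lookup S v
... | true  | true  = refl
... | true  | false = refl
... | false | true  = refl
... | false | false = refl

∣⊥∩∣ : ∀ {n} (S : Subset n) → ∣ ⊥ ∩ S ∣ ≡ 0
∣⊥∩∣ {n} S = trans (cong ∣_∣ (Subset.∩-zeroˡ S)) (Subset.∣⊥∣≡0 n)

∣∷∣ : ∀ {n} b (S : Subset n) → ∣ b ∷ S ∣ ≡ χ b + ∣ S ∣
∣∷∣ true  S = refl
∣∷∣ false S = refl

∣⁅⁆∩∣ : ∀ {n} (u : Fin n) S → ∣ ⁅ u ⁆ ∩ S ∣ ≡ χ (lookup S u)
∣⁅⁆∩∣ zero    (b ∷ S) = trans (∣∷∣ b (⊥ ∩ S)) (trans (cong (χ b +_) (∣⊥∩∣ S)) (+-identityʳ (χ b)))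
∣⁅⁆∩∣ (suc u) (b ∷ S) = ∣⁅⁆∩∣ u S

-- Links the cardinality in the definition of `∂` to indicators. Distinctness of the endpoints
-- matters, as a repeated one would be counted once on the left and twice on the right.
∣pair∩∣ : ∀ {n} {u v : Fin n} → u Fin.< v → ∀ S →
  ∣ (⁅ u ⁆ ∪ ⁅ v ⁆) ∩ S ∣ ≡ χ (lookup S u) + χ (lookup S v)
∣pair∩∣ {u = zero}  {suc v} _         (b ∷ S) = trans (∣∷∣ b ((⊥ ∪ ⁅ v ⁆) ∩ S))
  (cong (χ b +_) (trans (cong (λ T → ∣ T ∩ S ∣) (Subset.∪-identityˡ ⁅ v ⁆)) (∣⁅⁆∩∣ v S)))
∣pair∩∣ {u = suc u} {suc v} (s≤s u<v) (b ∷ S) = ∣pair∩∣ u<v S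

χ+χ≡1 : ∀ a b → χ a + χ b ≡ 1 → χ (a xor b) ≡ 1
χ+χ≡1 true  false _ = refl
χ+χ≡1 false true  _ = refl

χ+χ≢1 : ∀ a b → χ a + χ b ≢ 1 → χ (a xor b) ≡ 0
χ+χ≢1 true  true  _   = refl
χ+χ≢1 true  false ≢1 = contradiction refl ≢1
χ+χ≢1 false true  ≢1 = contradiction refl ≢1
χ+χ≢1 false false _   = refl

∑-allFin-suc : ∀ {n} (f : Fin (suc n) → ℕ) →
  ∑ (allFin (suc n)) f ≡ f zero + ∑ (allFin n) (f ∘ suc)
∑-allFin-suc f = cong (λ xs → f zero + sum xs)
  (trans (map-tabulate suc f) (sym (map-tabulate id (f ∘ suc))))

∑-⁅⁆ : ∀ {n} (u : Fin n) → ∑ (allFin n) (λ v → χ (lookup ⁅ v ⁆ u)) ≡ 1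
∑-⁅⁆ {suc n} zero = trans (∑-allFin-suc {n} (λ v → χ (lookup ⁅ v ⁆ zero)))
  (cong suc (trans (∑-const 0 (allFin n)) (*-zeroʳ (length (allFin n)))))
∑-⁅⁆ {suc n} (suc u) = trans (∑-allFin-suc {n} (λ v → χ (lookup ⁅ v ⁆ (suc u))))
  (cong₂ _+_ (cong χ (lookup-replicate u outside)) (∑-⁅⁆ u))

∑-degrees≤2 : ∀ {n} (u w : Fin n) → ∑ (allFin n) (λ v → cut ⁅ v ⁆ u w) ≤ 2
∑-degrees≤2 {n} u w = begin
  ∑ (allFin n) (λ v → cut ⁅ v ⁆ u w)
    ≤⟨ ∑-mono (allFin n) (λ {v} _ → xor≤+ (lookup ⁅ v ⁆ u) (lookup ⁅ v ⁆ w)) ⟩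
  ∑ (allFin n) (λ v → χ (lookup ⁅ v ⁆ u) + χ (lookup ⁅ v ⁆ w))
    ≡⟨ ∑-+ (λ v → χ (lookup ⁅ v ⁆ u)) (λ v → χ (lookup ⁅ v ⁆ w)) (allFin n) ⟩
  ∑ (allFin n) (λ v → χ (lookup ⁅ v ⁆ u)) + ∑ (allFin n) (λ v → χ (lookup ⁅ v ⁆ w))
    ≡⟨ cong₂ _+_ (∑-⁅⁆ u) (∑-⁅⁆ w) ⟩
  2 ∎
  where
  open ≤-Reasoning
  xor≤+ : ∀ a b → χ (a xor b) ≤ χ a + χ b
  xor≤+ true  true  = z≤n
  xor≤+ true  false = ≤-refl
  xor≤+ false b     = ≤-refl

-- Scaled cycles satisfy the degree and capacity constraints

module _ {m : ℕ} (G : Graph (suc m)) (3≤n : 3 ≤ suc m)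
  {y : Edge G → ℕ} {d : ℕ} (scaled : ScaledCycle G y d) where
  open Edge

  private
    n = suc m
    es = edges G

  open ≤-Reasoning

  cutWeight : Subset n → ℕ
  cutWeight S = ∑ es λ e → cutᴱ G S e * y e

  -- `ScaledCycle` only constrains sides missing `zero`; a set containing `zero` is replaced by its
  -- complement, which has the same cut and is nonempty because the set is proper.
  cutWeight≥2d : ∀ S → Nonempty S → S ⊂ ⊤ → 2 * d ≤ cutWeight S
  cutWeight≥2d (false ∷ S) (suc x , there x∈S) _ = proj₂ (proj₂ scaled) S (x , x∈S)
  cutWeight≥2d (true ∷ S) _ (_ , zero , _ , 0∉S) = contradiction here 0∉S
  cutWeight≥2d (true ∷ S) _ (_ , suc x , _ , x∉S) = subst (2 * d ≤_)
    (∑-cong (λ e → cong (_* y e) (cut-∁ (true ∷ S) (src e) (tgt e))) es)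
    (proj₂ (proj₂ scaled) (∁ S) (x , Subset.x∉p⇒x∈∁p (λ x∈S → x∉S (there x∈S))))

  ∑≤nd : ∑ es y ≤ n * d
  ∑≤nd = proj₁ (proj₂ scaled)

  degree : Fin n → ℕ
  degree v = cutWeight ⁅ v ⁆

  degree≥2d : ∀ v → 2 * d ≤ degree v
  degree≥2d v = cutWeight≥2d ⁅ v ⁆ (v , Subset.x∈⁅x⁆ v)
    (small⇒proper (subst (_< n) (sym (Subset.∣⁅x⁆∣≡1 v)) (≤-trans (s≤s (s≤s z≤n)) 3≤n)))

  ∑-degree≤ : ∑ (allFin n) degree ≤ 2 * ∑ es y
  ∑-degree≤ = begin
    ∑ (allFin n) (λ v → ∑ es (λ e → cutᴱ G ⁅ v ⁆ e * y e))
      ≡⟨ ∑-swap (λ v e → cutᴱ G ⁅ v ⁆ e * y e) (allFin n) es ⟩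
    ∑ es (λ e → ∑ (allFin n) (λ v → cutᴱ G ⁅ v ⁆ e * y e))
      ≡⟨ ∑-cong (λ e → ∑-*ʳ (λ v → cutᴱ G ⁅ v ⁆ e) (y e) (allFin n)) es ⟩
    ∑ es (λ e → ∑ (allFin n) (λ v → cutᴱ G ⁅ v ⁆ e) * y e)
      ≤⟨ ∑-mono es (λ {e} _ → *-monoˡ-≤ (y e) (∑-degrees≤2 (src e) (tgt e))) ⟩
    ∑ es (λ e → 2 * y e)
      ≡⟨ ∑-cong (λ e → *-comm 2 (y e)) es ⟩
    ∑ es (λ e → y e * 2)
      ≡⟨ ∑-*ʳ y 2 es ⟩
    ∑ es y * 2
      ≡⟨ *-comm (∑ es y) 2 ⟩
    2 * ∑ es y ∎

  ∑2d : ∑ (allFin n) (λ _ → 2 * d) ≡ 2 * (n * d)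
  ∑2d = trans (∑-const (2 * d) (allFin n))
    (trans (cong (_* (2 * d)) (length-tabulate {n = n} id)) (lem n d))
    where
    lem : ∀ n d → n * (2 * d) ≡ 2 * (n * d)
    lem = solve-∀

  -- All degrees are at least `2 d`, and by double counting they add up to at most twice the total
  -- weight, which is therefore at least `n d`.
  total≡nd : ∑ es y ≡ n * d
  total≡nd = ≤-antisym ∑≤nd (*-cancelˡ-≤ 2 (begin
    2 * (n * d)                   ≡⟨ ∑2d ⟨
    ∑ (allFin n) (λ _ → 2 * d)    ≤⟨ ∑-mono (allFin n) (λ {v} _ → degree≥2d v) ⟩
    ∑ (allFin n) degree           ≤⟨ ∑-degree≤ ⟩
    2 * ∑ es y                    ∎))

  -- The degree sum is squeezed between `2 n d` and `2 n d`, which leaves no room for an excess at a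
  -- single vertex.
  degree≤2d : ∀ v → degree v ≤ 2 * d
  degree≤2d v = m∸n≡0⇒m≤n (n≤0⇒n≡0 (+-cancelˡ-≤ (2 * (n * d)) _ 0 (begin
    2 * (n * d) + (degree v ∸ 2 * d)
      ≡⟨ cong (_+ (degree v ∸ 2 * d)) ∑2d ⟨
    ∑ (allFin n) (λ _ → 2 * d) + (degree v ∸ 2 * d)
      ≤⟨ ∑-mono-excess {g = degree} degree≥2d (∈-allFin v) (≤-reflexive (m+[n∸m]≡n (degree≥2d v))) ⟩
    ∑ (allFin n) degree
      ≤⟨ ∑-degree≤ ⟩
    2 * ∑ es y
      ≤⟨ *-monoʳ-≤ 2 ∑≤nd ⟩
    2 * (n * d)
      ≡⟨ +-identityʳ _ ⟨
    2 * (n * d) + 0 ∎)))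

  -- The cut around the two ends of `e` counts both degrees except for `e`, which is lost twice. The
  -- degrees sum to at most `4 d` and the cut keeps at least `2 d`, hence `2 y e ≤ 2 d`. With three
  -- vertices or more the pair is a proper set.
  y≤d : ∀ e → y e ≤ d
  y≤d e = *-cancelˡ-≤ 2 (+-cancelˡ-≤ (2 * d) _ _ (begin
    2 * d + 2 * y e
      ≤⟨ +-monoˡ-≤ (2 * y e) (cutWeight≥2d pair (s , Subset.p⊆p∪q ⁅ t ⁆ (Subset.x∈⁅x⁆ s)) (small⇒proper pair<n)) ⟩
    cutWeight pair + 2 * y e
      ≤⟨ ∑-mono-excess {f = λ e′ → cutᴱ G pair e′ * y e′} pointwise (∈-edges G e) at-e ⟩
    ∑ es (λ e′ → cutᴱ G ⁅ s ⁆ e′ * y e′ + cutᴱ G ⁅ t ⁆ e′ * y e′)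
      ≡⟨ ∑-+ (λ e′ → cutᴱ G ⁅ s ⁆ e′ * y e′) (λ e′ → cutᴱ G ⁅ t ⁆ e′ * y e′) es ⟩
    degree s + degree t
      ≤⟨ +-mono-≤ (degree≤2d s) (degree≤2d t) ⟩
    2 * d + 2 * d ∎))
    where
    s t : Fin n
    s = src e
    t = tgt e

    pair : Subset n
    pair = ⁅ s ⁆ ∪ ⁅ t ⁆

    s≢t : s ≢ t
    s≢t = Fin.<⇒≢ (src<tgt e)

    pair<n : ∣ pair ∣ < n
    pair<n = ≤-trans (s≤s (begin
      ∣ pair ∣                   ≤⟨ m≤n+m _ ∣ ⁅ s ⁆ ∩ ⁅ t ⁆ ∣ ⟩
      ∣ ⁅ s ⁆ ∩ ⁅ t ⁆ ∣ + ∣ pair ∣ ≡⟨ ∣∩∣+∣∪∣ ⁅ s ⁆ ⁅ t ⁆ ⟩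
      ∣ ⁅ s ⁆ ∣ + ∣ ⁅ t ⁆ ∣        ≡⟨ cong₂ _+_ (Subset.∣⁅x⁆∣≡1 s) (Subset.∣⁅x⁆∣≡1 t) ⟩
      2                          ∎)) 3≤n

    pointwise : ∀ e′ → cutᴱ G pair e′ * y e′ ≤ cutᴱ G ⁅ s ⁆ e′ * y e′ + cutᴱ G ⁅ t ⁆ e′ * y e′
    pointwise e′ = begin
      cutᴱ G pair e′ * y e′
        ≤⟨ *-monoˡ-≤ (y e′) (≤-trans (m≤n+m _ (cutᴱ G (⁅ s ⁆ ∩ ⁅ t ⁆) e′))
             (cut-submodular ⁅ s ⁆ ⁅ t ⁆ (src e′) (tgt e′))) ⟩
      (cutᴱ G ⁅ s ⁆ e′ + cutᴱ G ⁅ t ⁆ e′) * y e′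
        ≡⟨ *-distribʳ-+ (y e′) (cutᴱ G ⁅ s ⁆ e′) _ ⟩
      cutᴱ G ⁅ s ⁆ e′ * y e′ + cutᴱ G ⁅ t ⁆ e′ * y e′ ∎

    pair-cut : cut pair s t ≡ 0
    pair-cut rewrite []=⇒lookup (Subset.p⊆p∪q ⁅ t ⁆ (Subset.x∈⁅x⁆ s))
                   | []=⇒lookup (Subset.q⊆p∪q ⁅ s ⁆ ⁅ t ⁆ (Subset.x∈⁅x⁆ t)) = refl

    s-cut : cut ⁅ s ⁆ s t ≡ 1
    s-cut rewrite lookup-⁅⁆ s | lookup-⁅⁆-≢ s≢t = refl

    t-cut : cut ⁅ t ⁆ s t ≡ 1
    t-cut rewrite lookup-⁅⁆ t | lookup-⁅⁆-≢ (≢-sym s≢t) = refl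

    at-e : cutᴱ G pair e * y e + 2 * y e ≤ cutᴱ G ⁅ s ⁆ e * y e + cutᴱ G ⁅ t ⁆ e * y e
    at-e rewrite pair-cut | s-cut | t-cut = ≤-reflexive (lem (y e))
      where
      lem : ∀ z → 2 * z ≡ 1 * z + 1 * z
      lem = solve-∀

-- Rational edge weights

-- Abstract, since unfolding frac would expose the gcd normalisation of ℚ.
abstract
  frac : ℕ → ℕ → ℚ
  frac d-1 a = ℚ.fromℚᵘ (mkℚᵘ (ℤ.+ a) d-1)

  frac-+ : ∀ d-1 a b → frac d-1 a ℚ.+ frac d-1 b ≡ frac d-1 (a + b)
  frac-+ d-1 a b = ℚ.toℚᵘ-injective (begin
    ℚ.toℚᵘ (frac d-1 a ℚ.+ frac d-1 b)
      ≈⟨ ℚ.toℚᵘ-homo-+ (frac d-1 a) (frac d-1 b) ⟩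
    ℚ.toℚᵘ (frac d-1 a) ℚᵘ.+ ℚ.toℚᵘ (frac d-1 b)
      ≈⟨ ℚᵘ.+-cong (ℚ.toℚᵘ-fromℚᵘ (mkℚᵘ (ℤ.+ a) d-1)) (ℚ.toℚᵘ-fromℚᵘ (mkℚᵘ (ℤ.+ b) d-1)) ⟩
    mkℚᵘ (ℤ.+ a) d-1 ℚᵘ.+ mkℚᵘ (ℤ.+ b) d-1
      ≈⟨ *≡* (common (ℤ.+ a) (ℤ.+ b) (ℤ.+ suc d-1)) ⟩
    mkℚᵘ (ℤ.+ (a + b)) d-1
      ≈⟨ ℚ.toℚᵘ-fromℚᵘ (mkℚᵘ (ℤ.+ (a + b)) d-1) ⟨
    ℚ.toℚᵘ (frac d-1 (a + b)) ∎)
    where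
    open ℚᵘ.≃-Reasoning
    common : ∀ a b D → (a ℤ.* D ℤ.+ b ℤ.* D) ℤ.* D ≡ (a ℤ.+ b) ℤ.* (D ℤ.* D)
    common = ℤSolver.solve-∀

  frac-≤ : ∀ d-1 a e-1 b → a * suc e-1 ≤ b * suc d-1 → frac d-1 a ℚ.≤ frac e-1 b
  frac-≤ d-1 a e-1 b le = ℚ.toℚᵘ-cancel-≤
    (ℚᵘ.≤-respˡ-≃ (ℚᵘ.≃-sym (ℚ.toℚᵘ-fromℚᵘ (mkℚᵘ (ℤ.+ a) d-1)))
      (ℚᵘ.≤-respʳ-≃ (ℚᵘ.≃-sym (ℚ.toℚᵘ-fromℚᵘ (mkℚᵘ (ℤ.+ b) e-1)))
        (*≤* (subst₂ ℤ._≤_ (ℤ.pos-* a (suc e-1)) (ℤ.pos-* b (suc d-1)) (ℤ.+≤+ le)))))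

  -- Stated inside the abstract block, where `frac` unfolds and the equation holds by computation.
  fromℕ≡frac : ∀ q k → seq (fromℕ q) k ≡ frac 0 q
  fromℕ≡frac q k = refl

-- The sequences are assumed constant up to propositional equality, since a sum of weights over
-- edges reduces to a single fraction only by a proof.
≤ʳ-constant : ∀ x y p q → (∀ k → seq x k ≡ p) → (∀ k → seq y k ≡ q) → p ℚ.≤ q → x ≤ʳ y
≤ʳ-constant _ _ p q x≡p y≡q p≤q ε 0<ε = 0 , λ k _ →
  subst₂ (λ a b → a ℚ.< b ℚ.+ ε) (sym (x≡p k)) (sym (y≡q k))
    (ℚ.≤-<-trans p≤q (subst (ℚ._< q ℚ.+ ε) (ℚ.+-identityʳ q) (ℚ.+-monoʳ-< q 0<ε)))

≈ʳ-constant : ∀ x y p → (∀ k → seq x k ≡ p) → (∀ k → seq y k ≡ p) → x ≈ʳ y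
≈ʳ-constant _ _ p x≡p y≡p ε 0<ε = 0 , λ k _ →
  subst₂ (λ a b → ℚ.∣ a ℚ.- b ∣ ℚ.< ε) (sym (x≡p k)) (sym (y≡p k))
    (subst (λ z → ℚ.∣ z ∣ ℚ.< ε) (sym (ℚ.+-inverseʳ p)) 0<ε)

module _ {n : ℕ} {G : Graph n} (y : Edge G → ℕ) (d-1 : ℕ) where

  scaledWeight : Edge G → ℝ
  scaledWeight e = fromℚ (frac d-1 (y e))

  -- The indicator `c` replaces the filter by a factor, the form in which the cut constraints of
  -- `ScaledCycle` are stated.
  seq-sum-filter : ∀ {P : Pred (Edge G) 0ℓ} (P? : Decidable P) (c : Edge G → ℕ) →
    (∀ {e} → P e → c e ≡ 1) → (∀ {e} → ¬ P e → c e ≡ 0) → ∀ es k →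
    seq (sumℝ (map scaledWeight (filter P? es))) k ≡ frac d-1 (∑ es λ e → c e * y e)
  -- The empty sum is zero with denominator 1, while the right-hand side is zero with denominator
  -- `suc d-1`.
  seq-sum-filter P? c in≡1 out≡0 [] k = trans (fromℕ≡frac 0 k)
    (ℚ.≤-antisym (frac-≤ 0 0 d-1 0 z≤n) (frac-≤ d-1 0 0 0 z≤n))
  seq-sum-filter P? c in≡1 out≡0 (e ∷ es) k with P? e
  ... | yes Pe = trans (cong (frac d-1 (y e) ℚ.+_) (seq-sum-filter P? c in≡1 out≡0 es k))
    (trans (frac-+ d-1 (y e) _) (cong (λ z → frac d-1 (z + ∑ es λ e → c e * y e))
      (sym (trans (cong (_* y e) (in≡1 Pe)) (*-identityˡ (y e))))))
  ... | no ¬Pe = trans (seq-sum-filter P? c in≡1 out≡0 es k)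
    (cong (λ z → frac d-1 (z * y e + ∑ es λ e → c e * y e)) (sym (out≡0 ¬Pe)))

scaled⇒fractional : ∀ {m} (G : Graph (suc m)) → 3 ≤ suc m → ∃₂ (ScaledCycle G) → FractionallyHamiltonian G
scaled⇒fractional {m} G 3≤n (y , suc d-1 , scaled) = f , record
  { 0≤f   = λ e → ≤ʳ-constant (fromℕ 0) (f e) (frac 0 0) (frac d-1 (y e)) (fromℕ≡frac 0) (λ _ → refl)
              (frac-≤ 0 0 d-1 (y e) z≤n)
  ; f≤1   = λ e → ≤ʳ-constant (f e) (fromℕ 1) (frac d-1 (y e)) (frac 0 1) (λ _ → refl) (fromℕ≡frac 1)
              (frac-≤ d-1 (y e) 0 1
                (subst₂ _≤_ (sym (*-identityʳ (y e))) (sym (*-identityˡ d)) (y≤d G 3≤n scaled e)))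
  ; total = ≈ʳ-constant (weight f U?) (fromℕ n) (frac 0 n)
              (λ k → trans
                (seq-sum-filter y d-1 U? (λ _ → 1) (λ _ → refl) (λ ¬u → contradiction _ ¬u) (edges G) k)
                total≡n)
              (fromℕ≡frac n)
  ; cut   = λ S ne S⊂⊤ → ≤ʳ-constant (fromℕ 2) (weight f (∂? S))
              (frac 0 2) (frac d-1 (∑ (edges G) λ e → cutᴱ G S e * y e)) (fromℕ≡frac 2)
              (λ k → seq-sum-filter y d-1 (∂? S) (cutᴱ G S) (λ {e} → in-∂ S e) (λ {e} → out-∂ S e) (edges G) k)
              (frac-≤ 0 2 d-1 (∑ (edges G) λ e → cutᴱ G S e * y e)
                (subst (2 * d ≤_) (sym (*-identityʳ _)) (cutWeight≥2d G 3≤n scaled S ne S⊂⊤)))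
  }
  where
  open Edge

  n d : ℕ
  n = suc m
  d = suc d-1

  f : Edge G → ℝ
  f = scaledWeight y d-1

  total≡n : frac d-1 (∑ (edges G) (λ e → 1 * y e)) ≡ frac 0 n
  total≡n = ℚ.≤-antisym (frac-≤ d-1 total 0 n (≤-reflexive eq)) (frac-≤ 0 n d-1 total (≤-reflexive (sym eq)))
    where
    total : ℕ
    total = ∑ (edges G) (λ e → 1 * y e)

    eq : total * 1 ≡ n * d
    eq = trans (*-identityʳ _) (trans (∑-cong (λ e → *-identityˡ (y e)) (edges G)) (total≡nd G 3≤n scaled))

  in-∂ : ∀ S e → ∂ S e → cutᴱ G S e ≡ 1
  in-∂ S e e∈∂ = χ+χ≡1 (lookup S (src e)) (lookup S (tgt e)) (trans (sym (∣pair∩∣ (src<tgt e) S)) e∈∂)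

  out-∂ : ∀ S e → ¬ ∂ S e → cutᴱ G S e ≡ 0
  out-∂ S e e∉∂ = χ+χ≢1 (lookup S (src e)) (lookup S (tgt e)) (λ eq → e∉∂ (trans (∣pair∩∣ (src<tgt e) S) eq))

-- From a cut packing to the chordal supergraph

threshold-contains : ∀ {m} (G : Graph (suc m)) L L′ k →
  (∀ (e : Edge G) → dist L (Edge.src e) (Edge.tgt e) ≤ k) →
  (∀ u v → dist L′ u v ≤ dist L u v) → G SpanningSubgraphOf threshold L′ k
threshold-contains G L L′ k bounded shorter u v uv with Fin.<-cmp u v
... | tri< u<v u≢v _ = near⇒adj L′ k (u≢v , ≤-trans (shorter u v) (bounded (mkEdge u v u<v uv)))
... | tri≈ _ refl _  = contradiction uv (subst (λ b → ¬ T b) (sym (Graph.irrefl G u)) id)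
... | tri> _ u≢v v<u = near⇒adj L′ k (near-sym L′ k
  (≢-sym u≢v , ≤-trans (shorter v u) (bounded (mkEdge v u v<u (subst T (Graph.symm G u v) uv)))))

theorem1 : (n : ℕ) → 3 ≤ᴺ n → (G : Graph n) → Connected G → ¬ FractionallyHamiltonian G →
    ∃ λ (H : Graph n) → G SpanningSubgraphOf H × Chordal H × ¬ Hamiltonian H
theorem1 (suc m) 3≤n G _ ¬fractional with duality G
... | inj₁ solution = contradiction (scaled⇒fractional G 3≤n solution) ¬fractional
... | inj₂ (L , k , nonempty , bounded , violated)
  with L′ , nonempty′ , length≡ , shorter , laminar ← uncross L nonempty =
  threshold L′ k
  , threshold-contains G L L′ k bounded shorter
  , threshold-chordal L′ k laminar
  , threshold-non-Hamiltonian L′ k nonempty′ (subst (λ l → suc m * k < 2 * l) (sym length≡) violated)
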